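{- The permutations $213$ and $2431$ form an annihilator pair: for every permutation $\tau$ and every pair of distinct indices $i,j\le|\tau|$, the permutation $\tau_{i,j}[213,2431]$ satisfies $\mu[1,\tau_{i,j}[213,2431]]=0$.
   Context: Permutations are ordered by containment: $\sigma\le\pi$ if $\pi$ has a subsequence order-isomorphic to $\sigma$. The Möbius function: $\mu[\sigma,\pi]=0$ if $\sigma\not\le\pi$, $\mu[\sigma,\pi]=1$ if $\sigma=\pi$, and $\mu[\sigma,\pi]=-\sum_{\sigma\le\tau<\pi}\mu[\sigma,\tau]$ otherwise; $1$ is the permutation of length one. For a permutation $\tau$ of length $m$, distinct indices $i,j\le m$ and non-empty permutations $\phi,\psi$, the inflation $\tau_{i,j}[\phi,\psi]$ is the permutation obtained from $\tau$ by replacing the entry $\tau_i$ by a block of $|\phi|$ consecutive positions whose values form a set of consecutive integers and are order-isomorphic to $\phi$, replacing $\tau_j$ likewise by a block order-isomorphic to $\psi$, and keeping every other entry as a single entry, so that the relative order between different blocks/entries is that of the corresponding entries of $\tau$. -}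

module Defs where

open import Data.Bool using (Bool; true; false; if_then_else_; _∧_; not)
open import Data.Nat using (ℕ; zero; suc; _+_; _<?_; _<ᵇ_; _≡ᵇ_)
open import Data.Integer using (ℤ; 0ℤ; 1ℤ; -_) renaming (_+_ to _+ℤ_)
open import Data.List using (List; []; _∷_; [_]; _++_; map; length; filter; filterᵇ; upTo; zip; concatMap; foldr; deduplicate)
open import Data.Bool.ListAction using (any)
open import Data.Nat.ListAction using (sum)
open import Data.List.Properties using (≡-dec)
open import Data.Product using (_×_; _,_)
open import Relation.Nullary.Decidable using (Dec; yes; no; ⌊_⌋)
open import Relation.Binary.PropositionalEquality using (_≡_)
import Data.Nat as N

-- Permutations are lists of naturals; a permutation of length n is a
-- rearrangement of 1,2,...,n (one-line notation, 1-based values).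

_≟L_ : (xs ys : List ℕ) → Dec (xs ≡ ys)
_≟L_ = ≡-dec N._≟_

oneTo : ℕ → List ℕ
oneTo n = map suc (upTo n)

-- standardisation: replace each entry by its rank (1-based) among the entries;
-- for a list of distinct naturals this is the unique permutation
-- order-isomorphic to it.
std : List ℕ → List ℕ
std xs = map (λ x → suc (length (filter (λ y → y <? x) xs))) xs

subseqs : {A : Set} → List A → List (List A)
subseqs [] = [ [] ]
subseqs (x ∷ xs) = map (x ∷_) (subseqs xs) ++ subseqs xs

contains : List ℕ → List ℕ → Bool
contains σ π = any (λ s → ⌊ std s ≟L σ ⌋) (subseqs π)

patterns : List ℕ → List (List ℕ)
patterns π = deduplicate _≟L_ (map std (subseqs π))

sumℤ : List ℤ → ℤ
sumℤ = foldr _+ℤ_ 0ℤ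

-- Möbius function with fuel: the recursion
--   μ[σ,π] = 0 if σ ≰ π, 1 if σ = π, - Σ_{σ ≤ τ < π} μ[σ,τ] otherwise.
-- The τ with τ < π are exactly the patterns of π different from π.
muF : ℕ → List ℕ → List ℕ → ℤ
muF zero σ π = 0ℤ
muF (suc f) σ π with σ ≟L π
... | yes _ = 1ℤ
... | no _ = if contains σ π
             then - sumℤ (map (muF f σ)
                       (filterᵇ (λ τ → contains σ τ ∧ not ⌊ τ ≟L π ⌋) (patterns π)))
             else 0ℤ

-- fuel |π|+1 suffices: every proper pattern τ of a permutation π is shorter.
μ : List ℕ → List ℕ → ℤ
μ σ π = muF (suc (length π)) σ π

-- Inflation τ_{i,j}[φ,ψ], with positions i, j 0-based (i.e. the paper's
-- τ_{i+1} and τ_{j+1}) and φ, ψ permutations with values 1..|φ|, 1..|ψ|.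
inflate : List ℕ → ℕ → ℕ → List ℕ → List ℕ → List ℕ
inflate τ i j φ ψ = concatMap piece indexed
  where
    indexed : List (ℕ × ℕ)
    indexed = zip (upTo (length τ)) τ
    block : ℕ → List ℕ
    block k = if k ≡ᵇ i then φ else (if k ≡ᵇ j then ψ else [ 1 ])
    size : ℕ → ℕ
    size k = length (block k)
    base : ℕ → ℕ
    base v = sum (map (λ { (l , w) → if w <ᵇ v then size l else 0 }) indexed)
    piece : ℕ × ℕ → List ℕ
    piece (k , v) = map (base v +_) (block k)

{-# OPTIONS --safe #-}
module Submission where

-- Write [a,b] for the ideal of permutations contained in the inflation with 213 thinned to a
-- sub-pattern a and 2431 to b; μ[1,·] sums to 0 over every ideal generated by a permutation of
-- length ≠ 1. By induction, μ[1,ρ] vanishes as soon as ρ has both an ascending and a descending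
-- interval of length 2, or an interval 321, or intervals 213 and 2431. On the remaining ρ below
-- the inflation, the integer combination
--   [12,231] + [21,2431] + [213,132] - [1,231] - [12,12] - [21,132] + [1,12]
-- of indicator functions equals 1: if ρ has no descending interval, all terms but the first, which
-- is 1, cancel; if it has no ascending interval, what is left is [21,2431] + [213,132] - [21,132],
-- and ρ lies in one of the first two ideals, and in the third iff it lies in both. Summing μ[1,ρ] times this
-- combination over the patterns of the inflation leaves only the top term, which is thus 0.
-- The two auxiliary vanishing results (321, and ascent with descent) are proved in the same way.

open import Defs
open import Data.Bool using (Bool; true; false; if_then_else_; _∧_; not; T)
open import Data.Bool.ListAction using (any)
open import Data.Empty using (⊥-elim)
open import Data.Fin using (Fin; toℕ; zero; suc)
import Data.Fin.Properties as Fin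
open import Data.Integer using (ℤ; 0ℤ; 1ℤ; -1ℤ; -_) renaming (_+_ to _+ℤ_; _*_ to _*ℤ_)
import Data.Integer.Properties as ℤ
open import Data.Integer.Tactic.RingSolver using (solve-∀)
open import Data.List using (List; _∷_; []; [_]; length; map; filter; filterᵇ; _++_; zip; applyUpTo; concatMap)
open import Data.List.Membership.DecPropositional _≟L_ using (_∈?_)
open import Data.List.Membership.Propositional using (_∈_; find; lose)
open import Data.List.Membership.Propositional.Properties using (∈-map⁺; ∈-map⁻; ∈-++⁺ˡ; ∈-++⁺ʳ; ∈-++⁻; ∈-deduplicate⁺; ∈-deduplicate⁻; ∈-filter⁺; ∈-filter⁻; ∈-concatMap⁻)
open import Data.List.Membership.Propositional.Properties.WithK using (unique∧set⇒bag)
open import Data.List.Properties using (∷-injective; map-++; map-∘; map-cong-local; map-id-local; length-map; length-++; ++-assoc; ++-identityʳ; filter-accept; filter-reject; concatMap-++)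
open import Data.List.Relation.Binary.BagAndSetEquality using (∼bag⇒↭)
open import Data.List.Relation.Binary.Equality.Propositional using (≋⇒≡)
open import Data.List.Relation.Binary.Permutation.Propositional using (_↭_; ↭-sym; ↭⇒↭ₛ)
import Data.List.Relation.Binary.Permutation.Propositional.Properties as Perm
open import Data.List.Relation.Binary.Permutation.Setoid.Properties using (foldr-commMonoid; Unique-resp-↭)
open import Data.List.Relation.Binary.Sublist.Propositional using (_⊆_; []; _∷_; _∷ʳ_; ⊆-refl; ⊆-trans; minimum; lookup)
import Data.List.Relation.Binary.Sublist.Propositional.Properties as Sub
open import Data.List.Relation.Unary.All using (All; []; _∷_; all?)
import Data.List.Relation.Unary.All as All
import Data.List.Relation.Unary.All.Properties as All
open import Data.List.Relation.Unary.AllPairs using ([]; _∷_)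
open import Data.List.Relation.Unary.Any using (Any; here; there)
import Data.List.Relation.Unary.Any.Properties as Any
open import Data.List.Relation.Unary.Unique.DecPropositional.Properties _≟L_ using (deduplicate-!)
open import Data.List.Relation.Unary.Unique.Propositional using (Unique)
import Data.List.Relation.Unary.Unique.Propositional.Properties as Unique
open import Data.Nat using (ℕ; zero; suc; _+_; _≤_; _<_; z≤n; s≤s; _<?_; _≤?_; _≡ᵇ_; _<ᵇ_)
import Data.Nat as ℕ
import Data.Nat.Properties as ℕ
open import Data.List.Membership.DecPropositional ℕ._≟_ using () renaming (_∈?_ to _∈ℕ?_)
open import Data.List.Relation.Binary.Sublist.DecPropositional ℕ._≟_ using (_⊆?_)
open import Data.Nat.ListAction using (sum)
open import Data.Nat.Tactic.RingSolver using () renaming (solve-∀ to ℕ-solve-∀)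
open import Data.Product using (∃; ∃₂; _×_; _,_; proj₁; proj₂)
open import Data.Sum using (_⊎_; inj₁; inj₂; [_,_]′)
import Data.Sum as Sum
open import Function using (_∘_; id; case_of_; mk⇔)
open import Relation.Binary.Definitions using (tri<; tri≈; tri>)
open import Relation.Binary.PropositionalEquality using (_≡_; _≢_; refl; sym; trans; cong; cong₂; subst; subst₂; setoid; module ≡-Reasoning)
open import Relation.Nullary using (¬_; Dec; yes; no; contradiction)
open import Relation.Nullary.Decidable using (True; toWitness; ⌊_⌋; does; T?; _⊎-dec_; _×-dec_)
open import Relation.Unary using (Decidable)

-- Standardisation and order isomorphism

below : ℕ → List ℕ → ℕ
below x xs = length (filter (_<? x) xs)

-- `std xs` unfolds to `map (rank xs) xs`, so standardisation is itself a map by a function that is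
-- strictly monotone on the entries.
rank : List ℕ → ℕ → ℕ
rank xs x = suc (below x xs)

below-accept : ∀ {x y} ys → y < x → below x (y ∷ ys) ≡ suc (below x ys)
below-accept {x} ys y<x = cong length (filter-accept (_<? x) y<x)

below-reject : ∀ {x y} ys → ¬ y < x → below x (y ∷ ys) ≡ below x ys
below-reject {x} ys y≮x = cong length (filter-reject (_<? x) y≮x)

below-mono-≤ : ∀ {x y} xs → x ≤ y → below x xs ≤ below y xs
below-mono-≤ [] _ = z≤n
below-mono-≤ {x} {y} (z ∷ zs) x≤y with z <? x | z <? y
... | yes z<x | yes z<y rewrite below-accept zs z<x | below-accept zs z<y = s≤s (below-mono-≤ zs x≤y)
... | yes z<x | no z≮y = contradiction (ℕ.<-≤-trans z<x x≤y) z≮y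
... | no z≮x | yes z<y rewrite below-reject zs z≮x | below-accept zs z<y = ℕ.m≤n⇒m≤1+n (below-mono-≤ zs x≤y)
... | no z≮x | no z≮y rewrite below-reject zs z≮x | below-reject zs z≮y = below-mono-≤ zs x≤y

below-mono-< : ∀ {x y xs} → x ∈ xs → x < y → below x xs < below y xs
below-mono-< {x} {y} {_ ∷ zs} (here refl) x<y
  rewrite below-reject zs (ℕ.<-irrefl {x} refl) | below-accept zs x<y = s≤s (below-mono-≤ zs (ℕ.<⇒≤ x<y))
below-mono-< {x} {y} {z ∷ zs} (there x∈) x<y with z <? x | z <? y
... | yes z<x | yes z<y rewrite below-accept zs z<x | below-accept zs z<y = s≤s (below-mono-< x∈ x<y)
... | yes z<x | no z≮y = contradiction (ℕ.<-trans z<x x<y) z≮y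
... | no z≮x | yes z<y rewrite below-reject zs z≮x | below-accept zs z<y = ℕ.m<n⇒m<1+n (below-mono-< x∈ x<y)
... | no z≮x | no z≮y rewrite below-reject zs z≮x | below-reject zs z≮y = below-mono-< x∈ x<y

rank-cancel-< : ∀ xs {x y} → rank xs x < rank xs y → x < y
rank-cancel-< xs {x} {y} r = ℕ.≰⇒> λ y≤x → ℕ.<⇒≱ r (s≤s (below-mono-≤ xs y≤x))

StrictOn : (ℕ → ℕ) → List ℕ → Set
StrictOn f xs = ∀ {x y} → x ∈ xs → y ∈ xs → x < y → f x < f y

StrictOn-⊆ : ∀ {f xs ys} → xs ⊆ ys → StrictOn f ys → StrictOn f xs
StrictOn-⊆ s m x∈ y∈ = m (lookup s x∈) (lookup s y∈)

StrictOn-cancel-< : ∀ {f xs} → StrictOn f xs → ∀ {x y} → x ∈ xs → y ∈ xs → f x < f y → x < y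
StrictOn-cancel-< {f} m {x} {y} x∈ y∈ fx<fy with ℕ.<-cmp x y
... | tri< x<y _ _ = x<y
... | tri≈ _ refl _ = contradiction fx<fy (ℕ.<-irrefl refl)
... | tri> _ _ y<x = contradiction (m y∈ x∈ y<x) (ℕ.<-asym fx<fy)

rank-strict : ∀ xs → StrictOn (rank xs) xs
rank-strict xs x∈ _ x<y = s≤s (below-mono-< x∈ x<y)

-- Ranks count comparisons, and `f` preserves and reflects these on the entries of `xs`. The
-- induction `go` lets only the list of competitors shrink, because `x` need not lie in its tail.
std-map : ∀ {f} xs → StrictOn f xs → std (map f xs) ≡ std xs
std-map {f} xs m = trans (sym (map-∘ xs)) (map-cong-local (All.tabulate λ x∈ → cong suc (go x∈ ⊆-refl)))
  where
  go : ∀ {x ys} → x ∈ xs → ys ⊆ xs → below (f x) (map f ys) ≡ below x ys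
  go {ys = []} _ _ = refl
  go {x} {y ∷ ys} x∈ ys⊆ with f y <? f x | y <? x
  ... | yes p | yes q rewrite below-accept (map f ys) p | below-accept ys q = cong suc (go x∈ (⊆-trans (y ∷ʳ ⊆-refl) ys⊆))
  ... | no ¬p | no ¬q rewrite below-reject (map f ys) ¬p | below-reject ys ¬q = go x∈ (⊆-trans (y ∷ʳ ⊆-refl) ys⊆)
  ... | yes p | no ¬q = contradiction (StrictOn-cancel-< {f} m (lookup ys⊆ (here refl)) x∈ p) ¬q
  ... | no ¬p | yes q = contradiction (m (lookup ys⊆ (here refl)) x∈ q) ¬p

length-std : ∀ xs → length (std xs) ≡ length xs
length-std xs = length-map (rank xs) xs

std-idem : ∀ xs → std (std xs) ≡ std xs
std-idem xs = std-map xs (rank-strict xs)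

search : (ℕ → ℕ) → ℕ → List ℕ → ℕ
search r k [] = 0
search r k (x ∷ xs) with r x ℕ.≟ k
... | yes _ = x
... | no _ = search r k xs

search-correct : ∀ r {x} xs → x ∈ xs → (∀ {y} → y ∈ xs → r y ≡ r x → y ≡ x) → search r (r x) xs ≡ x
search-correct r {x} (y ∷ ys) x∈ inj with r y ℕ.≟ r x
... | yes eq = inj (here refl) eq
search-correct r (y ∷ ys) (here refl) inj | no ne = contradiction refl ne
search-correct r (y ∷ ys) (there x∈) inj | no _ = search-correct r ys x∈ (inj ∘ there)

unrank : List ℕ → ℕ → ℕ
unrank xs k = search (rank xs) k xs

unrank-rank : ∀ xs {x} → x ∈ xs → unrank xs (rank xs x) ≡ x
unrank-rank xs {x} x∈ = search-correct (rank xs) xs x∈ same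
  where
  same : ∀ {y} → y ∈ xs → rank xs y ≡ rank xs x → y ≡ x
  same {y} y∈ eq with ℕ.<-cmp y x
  ... | tri< y<x _ _ = contradiction (rank-strict xs y∈ x∈ y<x) (ℕ.<-irrefl eq)
  ... | tri≈ _ y≡x _ = y≡x
  ... | tri> _ _ x<y = contradiction (rank-strict xs x∈ y∈ x<y) (ℕ.<-irrefl (sym eq))

-- The isomorphism sends an entry of `xs` to the entry of `ys` with the same rank. Equal ranks force
-- equal values, so a search finds the right entry.
std≡⇒iso : ∀ xs ys → std xs ≡ std ys → ∃ λ f → StrictOn f xs × map f xs ≡ ys
std≡⇒iso xs ys eq = f , strict , f-map
  where
  f : ℕ → ℕ
  f x = unrank ys (rank xs x)

  f-map : map f xs ≡ ys
  f-map = begin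
    map f xs                          ≡⟨ map-∘ xs ⟩
    map (unrank ys) (std xs)          ≡⟨ cong (map (unrank ys)) eq ⟩
    map (unrank ys) (std ys)          ≡⟨ map-∘ ys ⟨
    map (λ y → unrank ys (rank ys y)) ys ≡⟨ map-id-local (All.tabulate (unrank-rank ys)) ⟩
    ys                                ∎
    where open ≡-Reasoning

  partner : ∀ {x} → x ∈ xs → ∃ λ y → y ∈ ys × rank xs x ≡ rank ys y
  partner x∈ = ∈-map⁻ (rank ys) (subst (_ ∈_) eq (∈-map⁺ (rank xs) x∈))

  strict : StrictOn f xs
  strict x∈ x′∈ x<x′ with partner x∈ | partner x′∈ | rank-strict xs x∈ x′∈ x<x′
  ... | y , y∈ , r≡ | y′ , y′∈ , r′≡ | r<r′
    rewrite r≡ | r′≡ | unrank-rank ys y∈ | unrank-rank ys y′∈ = rank-cancel-< ys r<r′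

-- Intervals

Outside : List ℕ → ℕ → Set
Outside w c = (∀ {e} → e ∈ w → c < e) ⊎ (∀ {e} → e ∈ w → e < c)

Block : List ℕ → List ℕ → List ℕ → Set
Block X w Z = (∀ {c} → c ∈ X → Outside w c) × (∀ {c} → c ∈ Z → Outside w c)

-- Contiguity of values is expressed by the other entries lying above or below the whole block, not
-- by consecutive integers. In this form it survives order isomorphisms and passage to sublists,
-- where values have gaps.
record Interval (p L : List ℕ) : Set where
  constructor interval
  field
    {before block after} : List ℕ
    split : L ≡ before ++ block ++ after
    std-block : std block ≡ std p
    outside : Block before block after

Outside-⊆ : ∀ {w w′ c} → w′ ⊆ w → Outside w c → Outside w′ c
Outside-⊆ s = Sum.map (_∘ lookup s) (_∘ lookup s)

Block-⊆ : ∀ {X X′ w w′ Z Z′} → X′ ⊆ X → w′ ⊆ w → Z′ ⊆ Z → Block X w Z → Block X′ w′ Z′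
Block-⊆ sX sw sZ (bX , bZ) = Outside-⊆ sw ∘ bX ∘ lookup sX , Outside-⊆ sw ∘ bZ ∘ lookup sZ

Outside-map : ∀ {f L w c} → StrictOn f L → c ∈ L → (∀ {e} → e ∈ w → e ∈ L) → Outside w c → Outside (map f w) (f c)
Outside-map {f} m c∈ w∈ (inj₁ lo) = inj₁ λ e∈ → case ∈-map⁻ f e∈ of λ { (_ , e′∈ , refl) → m c∈ (w∈ e′∈) (lo e′∈) }
Outside-map {f} m c∈ w∈ (inj₂ hi) = inj₂ λ e∈ → case ∈-map⁻ f e∈ of λ { (_ , e′∈ , refl) → m (w∈ e′∈) c∈ (hi e′∈) }

Interval-resp-std : ∀ {p L M} → std L ≡ std M → Interval p L → Interval p M
Interval-resp-std {p} {L} {M} eq (interval {X} {w} {Z} refl sw (bX , bZ)) with std≡⇒iso L M eq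
... | f , m , refl = interval
  (trans (map-++ f X (w ++ Z)) (cong (map f X ++_) (map-++ f w Z)))
  (trans (std-map w (StrictOn-⊆ w⊆ m)) sw)
  ( (λ c∈ → case ∈-map⁻ f c∈ of λ { (_ , c′∈ , refl) → Outside-map {f} m (∈-++⁺ˡ c′∈) (lookup w⊆) (bX c′∈) })
  , (λ c∈ → case ∈-map⁻ f c∈ of λ { (_ , c′∈ , refl) → Outside-map {f} m (∈-++⁺ʳ X (∈-++⁺ʳ w c′∈)) (lookup w⊆) (bZ c′∈) }))
  where
  w⊆ : w ⊆ X ++ w ++ Z
  w⊆ = Sub.++⁺ˡ X (Sub.++⁺ʳ Z ⊆-refl)

Interval-resp-pattern : ∀ {p q L} → std p ≡ std q → Interval p L → Interval q L
Interval-resp-pattern eq (interval s b o) = interval s (trans b eq) o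

-- The interval of `p` is transported into the block, which is order-isomorphic to `p`. An entry
-- elsewhere in `L` is outside the large block, hence outside the small one.
Interval-trans : ∀ {p q L} → Interval q p → Interval p L → Interval q L
Interval-trans {p} iq (interval {X} {w} {Z} refl sw (bX , bZ)) with Interval-resp-std (sym sw) iq
... | interval {X′} {w′} {Z′} refl sw′ (bX′ , bZ′) = interval
  assoc
  sw′
  ( (λ c∈ → [ Outside-⊆ w′⊆ ∘ bX , bX′ ]′ (∈-++⁻ X c∈))
  , (λ c∈ → [ bZ′ , Outside-⊆ w′⊆ ∘ bZ ]′ (∈-++⁻ Z′ c∈)))
  where
  w′⊆ : w′ ⊆ X′ ++ w′ ++ Z′
  w′⊆ = Sub.++⁺ˡ X′ (Sub.++⁺ʳ Z′ ⊆-refl)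
  assoc : X ++ (X′ ++ w′ ++ Z′) ++ Z ≡ (X ++ X′) ++ w′ ++ (Z′ ++ Z)
  assoc = trans (cong (X ++_) (trans (++-assoc X′ (w′ ++ Z′) Z) (cong (X′ ++_) (++-assoc w′ Z′ Z))))
                (sym (++-assoc X X′ (w′ ++ Z′ ++ Z)))

-- Sublists and pattern containment

⊆-++⁻ : ∀ {s : List ℕ} xs {ys} → s ⊆ xs ++ ys → ∃₂ λ s₁ s₂ → s ≡ s₁ ++ s₂ × s₁ ⊆ xs × s₂ ⊆ ys
⊆-++⁻ [] s⊆ = [] , _ , refl , [] , s⊆
⊆-++⁻ (x ∷ xs) (.x ∷ʳ s⊆) with ⊆-++⁻ xs s⊆
... | s₁ , s₂ , eq , l , r = s₁ , s₂ , eq , x ∷ʳ l , r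
⊆-++⁻ (x ∷ xs) (refl ∷ s⊆) with ⊆-++⁻ xs s⊆
... | s₁ , s₂ , refl , l , r = x ∷ s₁ , s₂ , refl , refl ∷ l , r

⊆-map⁻ : ∀ {f : ℕ → ℕ} {s} xs → s ⊆ map f xs → ∃ λ t → s ≡ map f t × t ⊆ xs
⊆-map⁻ [] [] = [] , refl , []
⊆-map⁻ (x ∷ xs) (_ ∷ʳ s⊆) with ⊆-map⁻ xs s⊆
... | t , eq , t⊆ = t , eq , x ∷ʳ t⊆
⊆-map⁻ (x ∷ xs) (refl ∷ s⊆) with ⊆-map⁻ xs s⊆
... | t , refl , t⊆ = x ∷ t , refl , refl ∷ t⊆

infix 4 _≼_

-- Comparing standardisations makes containment invariant under order isomorphism on both sides, so
-- it applies to raw sublists as well.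
_≼_ : List ℕ → List ℕ → Set
ρ ≼ L = ∃ λ s → s ⊆ L × std s ≡ std ρ

≼-refl : ∀ {L} → L ≼ L
≼-refl = _ , ⊆-refl , refl

⊆⇒≼ : ∀ {s L} → s ⊆ L → s ≼ L
⊆⇒≼ s⊆ = _ , s⊆ , refl

≼-reflexive : ∀ {L M} → std L ≡ std M → L ≼ M
≼-reflexive eq = _ , ⊆-refl , sym eq

-- The isomorphism from `L` onto its occurrence in `M` carries the occurrence of `ρ` along.
≼-trans : ∀ {ρ L M} → ρ ≼ L → L ≼ M → ρ ≼ M
≼-trans (s , s⊆ , s≡) (t , t⊆ , t≡) with std≡⇒iso _ t (sym t≡)
... | f , m , refl = map f s , ⊆-trans (Sub.map⁺ f s⊆) t⊆ , trans (std-map s (StrictOn-⊆ s⊆ m)) s≡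

≼-length : ∀ {ρ L} → ρ ≼ L → length ρ ≤ length L
≼-length {ρ} (s , s⊆ , eq) = subst (_≤ _) (trans (sym (length-std s)) (trans (cong length eq) (length-std ρ))) (Sub.length-mono-≤ s⊆)

private variable
  A : Set
  ρ L M : List ℕ

⊆⇒∈-subseqs : ∀ {s xs : List A} → s ⊆ xs → s ∈ subseqs xs
⊆⇒∈-subseqs [] = here refl
⊆⇒∈-subseqs {xs = x ∷ xs} (_ ∷ʳ s⊆) = ∈-++⁺ʳ (map (x ∷_) (subseqs xs)) (⊆⇒∈-subseqs s⊆)
⊆⇒∈-subseqs (refl ∷ s⊆) = ∈-++⁺ˡ (∈-map⁺ (_ ∷_) (⊆⇒∈-subseqs s⊆))

∈-subseqs⇒⊆ : ∀ {s} (xs : List A) → s ∈ subseqs xs → s ⊆ xs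
∈-subseqs⇒⊆ [] (here refl) = []
∈-subseqs⇒⊆ (x ∷ xs) s∈ with ∈-++⁻ (map (x ∷_) (subseqs xs)) s∈
... | inj₂ s∈′ = x ∷ʳ ∈-subseqs⇒⊆ xs s∈′
... | inj₁ s∈′ with ∈-map⁻ (x ∷_) s∈′
...   | _ , t∈ , refl = refl ∷ ∈-subseqs⇒⊆ xs t∈

≼⇒∈-patterns : ρ ≼ L → std ρ ∈ patterns L
≼⇒∈-patterns (s , s⊆ , eq) = ∈-deduplicate⁺ _≟L_ (subst (_∈ _) eq (∈-map⁺ std (⊆⇒∈-subseqs s⊆)))

∈-patterns⇒≼ : ρ ∈ patterns L → ρ ≼ L × std ρ ≡ ρ
∈-patterns⇒≼ {L = L} ρ∈ with ∈-map⁻ std (∈-deduplicate⁻ _≟L_ (map std (subseqs L)) ρ∈)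
... | s , s∈ , refl = (s , ∈-subseqs⇒⊆ L s∈ , sym (std-idem s)) , std-idem s

patterns-unique : ∀ L → Unique (patterns L)
patterns-unique L = deduplicate-! (map std (subseqs L))

-- A sublist of full length is the whole list. This is what makes the Möbius recursion and the later
-- inductions on length well-founded.
≼-strict : ρ ≼ L → std ρ ≢ std L → length ρ < length L
≼-strict {ρ} ρ≼@(s , s⊆ , eq) ne = ℕ.≤∧≢⇒< (≼-length ρ≼) λ len → ne (trans (sym eq) (cong std (≋⇒≡ (Sub.to-≋ (trans (same s eq) len) s⊆))))
  where
  same : ∀ s → std s ≡ std ρ → length s ≡ length ρ
  same s eq = trans (sym (length-std s)) (trans (cong length eq) (length-std ρ))

-- Finite sums

∑ : List A → (A → ℤ) → ℤ
∑ xs h = sumℤ (map h xs)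

∑-cong : ∀ {h k : A → ℤ} xs → (∀ {x} → x ∈ xs → h x ≡ k x) → ∑ xs h ≡ ∑ xs k
∑-cong [] _ = refl
∑-cong (x ∷ xs) eq = cong₂ _+ℤ_ (eq (here refl)) (∑-cong xs (eq ∘ there))

∑-0 : (xs : List A) → ∑ xs (λ _ → 0ℤ) ≡ 0ℤ
∑-0 [] = refl
∑-0 (x ∷ xs) = trans (ℤ.+-identityˡ _) (∑-0 xs)

∑-+ : ∀ (xs : List A) h k → ∑ xs (λ x → h x +ℤ k x) ≡ ∑ xs h +ℤ ∑ xs k
∑-+ [] h k = refl
∑-+ (x ∷ xs) h k = trans (cong (h x +ℤ k x +ℤ_) (∑-+ xs h k)) (interchange (h x) (k x) (∑ xs h) (∑ xs k))
  where
  interchange : ∀ a b c d → (a +ℤ b) +ℤ (c +ℤ d) ≡ (a +ℤ c) +ℤ (b +ℤ d)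
  interchange = solve-∀

∑-* : ∀ (xs : List A) c h → ∑ xs (λ x → c *ℤ h x) ≡ c *ℤ ∑ xs h
∑-* [] c h = sym (ℤ.*-zeroʳ c)
∑-* (x ∷ xs) c h = trans (cong (c *ℤ h x +ℤ_) (∑-* xs c h)) (sym (ℤ.*-distribˡ-+ c (h x) (∑ xs h)))

∑-↭ : ∀ {xs ys : List A} h → xs ↭ ys → ∑ xs h ≡ ∑ ys h
∑-↭ h p = foldr-commMonoid (setoid ℤ) ℤ.+-0-isCommutativeMonoid (↭⇒↭ₛ (Perm.map⁺ h p))

∑-filter : ∀ {P : A → Set} (P? : Decidable P) xs h → ∑ (filter P? xs) h ≡ ∑ xs (λ x → if does (P? x) then h x else 0ℤ)
∑-filter P? [] h = refl
∑-filter P? (x ∷ xs) h with does (P? x)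
... | true = cong (h x +ℤ_) (∑-filter P? xs h)
... | false = trans (∑-filter P? xs h) (sym (ℤ.+-identityˡ _))

∑-filterᵇ : ∀ (p : A → Bool) xs h → ∑ (filterᵇ p xs) h ≡ ∑ xs (λ x → if p x then h x else 0ℤ)
∑-filterᵇ p = ∑-filter (T? ∘ p)

∑-set : ∀ {xs ys : List A} h → Unique xs → Unique ys → (∀ {x} → x ∈ xs → x ∈ ys) → (∀ {x} → x ∈ ys → x ∈ xs) →
        ∑ xs h ≡ ∑ ys h
∑-set h ux uy to from = ∑-↭ h (∼bag⇒↭ (unique∧set⇒bag ux uy (mk⇔ to from)))

indicator : List (List ℕ) → List ℕ → ℤ
indicator ys x = if does (x ∈? ys) then 1ℤ else 0ℤ

∈⇒indicator : ∀ {x ys} → x ∈ ys → indicator ys x ≡ 1ℤ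
∈⇒indicator {x} {ys} x∈ with x ∈? ys
... | yes _ = refl
... | no x∉ = contradiction x∈ x∉

∉⇒indicator : ∀ {x ys} → ¬ x ∈ ys → indicator ys x ≡ 0ℤ
∉⇒indicator {x} {ys} x∉ with x ∈? ys
... | yes x∈ = contradiction x∈ x∉
... | no _ = refl

-- Used to cut a sum over an ideal down to a smaller ideal inside it.
∑-indicator : ∀ {xs ys} h → Unique xs → Unique ys → (∀ {x} → x ∈ ys → x ∈ xs) →
              ∑ xs (λ x → indicator ys x *ℤ h x) ≡ ∑ ys h
∑-indicator {xs} {ys} h ux uy ys⊆xs = begin
  ∑ xs (λ x → indicator ys x *ℤ h x)                        ≡⟨ ∑-cong xs (λ {x} _ → pointwise x) ⟩
  ∑ xs (λ x → if does (x ∈? ys) then h x else 0ℤ)           ≡⟨ ∑-filter (_∈? ys) xs h ⟨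
  ∑ (filter (_∈? ys) xs) h                                  ≡⟨ ∑-set h (Unique.filter⁺ (_∈? ys) ux) uy (proj₂ ∘ ∈-filter⁻ (_∈? ys) {xs = xs}) (λ x∈ → ∈-filter⁺ (_∈? ys) (ys⊆xs x∈) x∈) ⟩
  ∑ ys h                                                    ∎
  where
  open ≡-Reasoning
  pointwise : ∀ x → indicator ys x *ℤ h x ≡ (if does (x ∈? ys) then h x else 0ℤ)
  pointwise x with x ∈? ys
  ... | yes _ = ℤ.*-identityˡ (h x)
  ... | no _ = ℤ.*-zeroˡ (h x)

-- The principal Möbius function

one : List ℕ
one = 1 ∷ []

-- One unit of fuel less than in `μ`. For standardised `ρ` this is enough, since the empty list has
-- value 0 with any fuel.
μ₁ : List ℕ → ℤ
μ₁ ρ = muF (length ρ) one ρ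

any-true : ∀ (p : A → Bool) {x xs} → x ∈ xs → p x ≡ true → any p xs ≡ true
any-true p (here refl) eq rewrite eq = refl
any-true p {xs = y ∷ _} (there x∈) eq with p y
... | true = refl
... | false = any-true p x∈ eq

contains-one : ∀ x xs → contains one (x ∷ xs) ≡ true
contains-one x xs = any-true (λ s → ⌊ std s ≟L one ⌋) (⊆⇒∈-subseqs (refl ∷ minimum xs)) std-single
  where
  std-single : ⌊ std (x ∷ []) ≟L one ⌋ ≡ true
  std-single rewrite below-reject [] (ℕ.<-irrefl {x} refl) = refl

below-patterns : List ℕ → List (List ℕ)
below-patterns L = filterᵇ (λ τ → contains one τ ∧ not ⌊ τ ≟L L ⌋) (patterns L)

muF-suc : ∀ f → one ≢ L → muF (suc f) one L ≡ (if contains one L then - ∑ (below-patterns L) (muF f one) else 0ℤ)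
muF-suc {L} f ne with one ≟L L
... | yes eq = contradiction eq ne
... | no _ = refl

muF-[] : ∀ f → muF f one [] ≡ 0ℤ
muF-[] zero = refl
muF-[] (suc f) = refl

∑-cong-below : ∀ L {h k : List ℕ → ℤ} → (∀ {ρ} → ρ ∈ patterns L → ρ ≢ L → h ρ ≡ k ρ) →
               ∑ (below-patterns L) h ≡ ∑ (below-patterns L) k
∑-cong-below L {h} {k} eq = trans (∑-filterᵇ p (patterns L) h)
  (trans (∑-cong (patterns L) pointwise) (sym (∑-filterᵇ p (patterns L) k)))
  where
  p : List ℕ → Bool
  p τ = contains one τ ∧ not ⌊ τ ≟L L ⌋
  pointwise : ∀ {ρ} → ρ ∈ patterns L → (if p ρ then h ρ else 0ℤ) ≡ (if p ρ then k ρ else 0ℤ)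
  pointwise {ρ} ρ∈ with contains one ρ | ρ ≟L L
  ... | false | _ = refl
  ... | true | yes _ = refl
  ... | true | no ne = eq ρ∈ ne

-- Each level of the recursion spends one unit, and the patterns of a standardised `ρ` other than
-- `ρ` itself are strictly shorter.
muF-fuel : ∀ f f′ ρ → std ρ ≡ ρ → length ρ ≤ f → length ρ ≤ f′ → muF f one ρ ≡ muF f′ one ρ
muF-fuel f f′ [] _ _ _ = trans (muF-[] f) (sym (muF-[] f′))
muF-fuel (suc f) (suc f′) ρ@(_ ∷ _) sρ (s≤s l) (s≤s l′) with one ≟L ρ
... | yes _ = refl
... | no _ = cong (λ z → if contains one ρ then - z else 0ℤ) (∑-cong-below ρ step)
  where
  step : ∀ {υ} → υ ∈ patterns ρ → υ ≢ ρ → muF f one υ ≡ muF f′ one υ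
  step {υ} υ∈ ne with ∈-patterns⇒≼ υ∈
  ... | υ≼ , sυ with ≼-strict υ≼ (λ eq → ne (trans (sym sυ) (trans eq sρ)))
  ...   | s≤s lt = muF-fuel f f′ υ sυ (ℕ.≤-trans lt l) (ℕ.≤-trans lt l′)

muF-uncontained : ∀ f → contains one ρ ≡ false → muF f one ρ ≡ 0ℤ
muF-uncontained {[]} f _ = muF-[] f
muF-uncontained {x ∷ ρ} f eq with () ← trans (sym (contains-one x ρ)) eq

-- If `L` is not standardised, then `std L` is a pattern of `L` of the same length, hence the
-- additional demand on the fuel.
muF-recurrence : ∀ f L → one ≢ L → length L ≤ suc f → (std L ≢ L → length L ≤ f) →
                 muF (suc f) one L +ℤ ∑ (patterns L) (λ ρ → if ⌊ ρ ≟L L ⌋ then 0ℤ else μ₁ ρ) ≡ 0ℤ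
muF-recurrence f [] _ _ _ = refl
muF-recurrence f L@(x ∷ xs) ne le le′ = begin
  muF (suc f) one L +ℤ rest              ≡⟨ cong (_+ℤ rest) (trans (muF-suc f ne) (cong (λ b → if b then - ∑ (below-patterns L) (muF f one) else 0ℤ) (contains-one x xs))) ⟩
  - ∑ (below-patterns L) (muF f one) +ℤ rest ≡⟨ cong (λ z → - z +ℤ rest) (trans (∑-cong-below L fuel) (trans (∑-filterᵇ _ (patterns L) μ₁) (∑-cong (patterns L) (λ {ρ} _ → pointwise ρ)))) ⟩
  - rest +ℤ rest                         ≡⟨ ℤ.+-inverseˡ rest ⟩
  0ℤ                                     ∎
  where
  open ≡-Reasoning
  rest : ℤ
  rest = ∑ (patterns L) (λ ρ → if ⌊ ρ ≟L L ⌋ then 0ℤ else μ₁ ρ)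
  fuel : ∀ {ρ} → ρ ∈ patterns L → ρ ≢ L → muF f one ρ ≡ μ₁ ρ
  fuel {ρ} ρ∈ ρ≢ with ∈-patterns⇒≼ ρ∈ | std L ≟L L
  ... | ρ≼ , sρ | no sL≢ = muF-fuel f _ ρ sρ (ℕ.≤-trans (≼-length ρ≼) (le′ sL≢)) ℕ.≤-refl
  ... | ρ≼ , sρ | yes sL = muF-fuel f _ ρ sρ (ℕ.≤-pred (ℕ.≤-trans (≼-strict ρ≼ (λ eq → ρ≢ (trans (sym sρ) (trans eq sL)))) le)) ℕ.≤-refl
  pointwise : ∀ ρ → (if contains one ρ ∧ not ⌊ ρ ≟L L ⌋ then μ₁ ρ else 0ℤ) ≡ (if ⌊ ρ ≟L L ⌋ then 0ℤ else μ₁ ρ)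
  pointwise ρ with ρ ≟L L | contains one ρ in eq
  ... | yes _ | true = refl
  ... | yes _ | false = refl
  ... | no _ | true = refl
  ... | no _ | false = sym (muF-uncontained {ρ} (length ρ) eq)

split-off : ∀ L → L ∈ patterns L → ∑ (patterns L) μ₁ ≡ μ₁ L +ℤ ∑ (patterns L) (λ ρ → if ⌊ ρ ≟L L ⌋ then 0ℤ else μ₁ ρ)
split-off L L∈ = begin
  ∑ P μ₁                                                          ≡⟨ ∑-cong P (λ {ρ} _ → pointwise ρ) ⟩
  ∑ P (λ ρ → indicator [ L ] ρ *ℤ μ₁ ρ +ℤ without ρ)              ≡⟨ ∑-+ P _ without ⟩
  ∑ P (λ ρ → indicator [ L ] ρ *ℤ μ₁ ρ) +ℤ ∑ P without            ≡⟨ cong (_+ℤ ∑ P without) (∑-indicator μ₁ (patterns-unique L) ([] ∷ []) λ { (here refl) → L∈ }) ⟩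
  (μ₁ L +ℤ 0ℤ) +ℤ ∑ P without                                     ≡⟨ cong (_+ℤ ∑ P without) (ℤ.+-identityʳ (μ₁ L)) ⟩
  μ₁ L +ℤ ∑ P without                                             ∎
  where
  open ≡-Reasoning
  P : List (List ℕ)
  P = patterns L
  without : List ℕ → ℤ
  without ρ = if ⌊ ρ ≟L L ⌋ then 0ℤ else μ₁ ρ
  pointwise : ∀ ρ → μ₁ ρ ≡ indicator [ L ] ρ *ℤ μ₁ ρ +ℤ without ρ
  pointwise ρ with ρ ≟L L
  ... | yes _ = sym (trans (ℤ.+-identityʳ _) (ℤ.*-identityˡ (μ₁ ρ)))
  ... | no _ = sym (trans (ℤ.+-identityˡ (μ₁ ρ)) refl)

∑-patterns-std : ∀ L h → ∑ (patterns L) h ≡ ∑ (patterns (std L)) h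
∑-patterns-std L h = ∑-set h (patterns-unique L) (patterns-unique (std L))
  (transfer {L} {std L} (≼-reflexive (sym (std-idem L)))) (transfer {std L} {L} (≼-reflexive (std-idem L)))
  where
  transfer : ∀ {M N} → M ≼ N → ∀ {ρ} → ρ ∈ patterns M → ρ ∈ patterns N
  transfer M≼N ρ∈ with ∈-patterns⇒≼ ρ∈
  ... | ρ≼ , sρ = subst (_∈ _) sρ (≼⇒∈-patterns (≼-trans ρ≼ M≼N))

-- `L` and `std L` generate the same ideal, and `std L` is its own top pattern, so there the
-- defining recurrence is exactly the claim.
∑-patterns : ∀ L → length L ≢ 1 → ∑ (patterns L) μ₁ ≡ 0ℤ
∑-patterns L len = trans (∑-patterns-std L μ₁) (go (std L) (std-idem L) (len ∘ trans (sym (length-std L))))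
  where
  go : ∀ M → std M ≡ M → length M ≢ 1 → ∑ (patterns M) μ₁ ≡ 0ℤ
  go [] _ _ = refl
  go M@(_ ∷ xs) sM len = trans (split-off M (subst (_∈ patterns M) sM (≼⇒∈-patterns (≼-refl {M}))))
    (muF-recurrence (length xs) M (λ { refl → len refl }) ℕ.≤-refl (contradiction sM))

μ-one≡0 : ∀ L → length L ≢ 1 → μ₁ (std L) ≡ 0ℤ → μ one L ≡ 0ℤ
μ-one≡0 L len eq with std L ≟L L
... | yes sL = trans (muF-fuel _ _ L sL (ℕ.n≤1+n _) ℕ.≤-refl) (subst (λ M → μ₁ M ≡ 0ℤ) sL eq)
-- Here `L` is not among its own patterns, so the recurrence subtracts the sum over the whole ideal,
-- which is 0. This case spares a proof that the inflation is standardised.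
... | no sL≢ = begin
  μ one L                                     ≡⟨ ℤ.+-identityʳ _ ⟨
  μ one L +ℤ 0ℤ                               ≡⟨ cong (μ one L +ℤ_) (∑-patterns L len) ⟨
  μ one L +ℤ ∑ (patterns L) μ₁                ≡⟨ cong (μ one L +ℤ_) (∑-cong (patterns L) L∉) ⟩
  μ one L +ℤ ∑ (patterns L) (λ ρ → if ⌊ ρ ≟L L ⌋ then 0ℤ else μ₁ ρ) ≡⟨ muF-recurrence (length L) L (λ { refl → len refl }) (ℕ.n≤1+n _) (λ _ → ℕ.≤-refl) ⟩
  0ℤ                                          ∎
  where
  open ≡-Reasoning
  L∉ : ∀ {ρ} → ρ ∈ patterns L → μ₁ ρ ≡ (if ⌊ ρ ≟L L ⌋ then 0ℤ else μ₁ ρ)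
  L∉ {ρ} ρ∈ with ρ ≟L L
  ... | yes refl = contradiction (proj₂ (∈-patterns⇒≼ {L = L} ρ∈)) sL≢
  ... | no _ = refl

-- Integer combinations of ideals

combination : List (ℤ × List ℕ) → List ℕ → ℤ
combination [] ρ = 0ℤ
combination ((k , M) ∷ ms) ρ = k *ℤ indicator (patterns M) ρ +ℤ combination ms ρ

-- The three conditions put the ideal of `M` inside that of `L`, keep `std L` out of it, and make
-- its sum of `μ₁` vanish.
Minor : List ℕ → List ℕ → Set
Minor L M = M ⊆ L × length M < length L × length M ≢ 1

∑-combination : ∀ ms → All (Minor L ∘ proj₂) ms → ∑ (patterns L) (λ ρ → combination ms ρ *ℤ μ₁ ρ) ≡ 0ℤ
∑-combination {L} [] [] = trans (∑-cong (patterns L) (λ {ρ} _ → ℤ.*-zeroˡ (μ₁ ρ))) (∑-0 (patterns L))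
∑-combination {L} ((k , M) ∷ ms) ((M⊆L , _ , len) ∷ minors) = begin
  ∑ P (λ ρ → (k *ℤ χ ρ +ℤ V ρ) *ℤ μ₁ ρ)                    ≡⟨ ∑-cong P (λ {ρ} _ → distrib k (χ ρ) (V ρ) (μ₁ ρ)) ⟩
  ∑ P (λ ρ → k *ℤ (χ ρ *ℤ μ₁ ρ) +ℤ V ρ *ℤ μ₁ ρ)            ≡⟨ ∑-+ P _ _ ⟩
  ∑ P (λ ρ → k *ℤ (χ ρ *ℤ μ₁ ρ)) +ℤ ∑ P (λ ρ → V ρ *ℤ μ₁ ρ) ≡⟨ cong₂ _+ℤ_ (∑-* P k _) (∑-combination ms minors) ⟩
  k *ℤ ∑ P (λ ρ → χ ρ *ℤ μ₁ ρ) +ℤ 0ℤ                       ≡⟨ cong (λ z → k *ℤ z +ℤ 0ℤ) (trans (∑-indicator μ₁ (patterns-unique L) (patterns-unique M) inclusion) (∑-patterns M len)) ⟩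
  k *ℤ 0ℤ +ℤ 0ℤ                                            ≡⟨ cong (_+ℤ 0ℤ) (ℤ.*-zeroʳ k) ⟩
  0ℤ                                                       ∎
  where
  open ≡-Reasoning
  P : List (List ℕ)
  P = patterns L
  χ V : List ℕ → ℤ
  χ = indicator (patterns M)
  V = combination ms
  distrib : ∀ k c v m → (k *ℤ c +ℤ v) *ℤ m ≡ k *ℤ (c *ℤ m) +ℤ v *ℤ m
  distrib = solve-∀
  inclusion : ∀ {ρ} → ρ ∈ patterns M → ρ ∈ P
  inclusion ρ∈ with ∈-patterns⇒≼ ρ∈
  ... | ρ≼ , sρ = subst (_∈ P) sρ (≼⇒∈-patterns (≼-trans ρ≼ (⊆⇒≼ M⊆L)))

combination-top : ∀ ms → All (Minor L ∘ proj₂) ms → combination ms (std L) ≡ 0ℤ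
combination-top [] [] = refl
combination-top {L} ((k , M) ∷ ms) ((_ , lt , _) ∷ minors)
  rewrite ∉⇒indicator {std L} {patterns M} (λ sL∈ → ℕ.<⇒≱ lt (subst (_≤ length M) (length-std L) (≼-length (proj₁ (∈-patterns⇒≼ {L = M} sL∈)))))
        | combination-top {L} ms minors = cong (_+ℤ 0ℤ) (ℤ.*-zeroʳ k)

-- Summing μ[1,·] over each ideal of the combination gives 0, so only the top element remains.
vanishing : ∀ L → length L ≢ 1 → (ms : List (ℤ × List ℕ)) → All (Minor L ∘ proj₂) ms →
            (∀ ρ → ρ ≼ L → std ρ ≡ ρ → length ρ < length L → μ₁ ρ ≡ 0ℤ ⊎ combination ms ρ ≡ 1ℤ) →
            μ₁ (std L) ≡ 0ℤ
vanishing L len ms minors cover = begin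
  μ₁ (std L)                                     ≡⟨ ℤ.+-identityʳ _ ⟨
  μ₁ (std L) +ℤ 0ℤ                               ≡⟨ cong₂ _+ℤ_ (sym top) (sym (∑-combination ms minors)) ⟩
  ∑ P (λ ρ → χ ρ *ℤ μ₁ ρ) +ℤ ∑ P (λ ρ → V ρ *ℤ μ₁ ρ) ≡⟨ ∑-+ P _ _ ⟨
  ∑ P (λ ρ → χ ρ *ℤ μ₁ ρ +ℤ V ρ *ℤ μ₁ ρ)         ≡⟨ ∑-cong P pointwise ⟨
  ∑ P μ₁                                         ≡⟨ ∑-patterns L len ⟩
  0ℤ                                             ∎
  where
  open ≡-Reasoning
  P : List (List ℕ)
  P = patterns L
  χ V : List ℕ → ℤ
  χ = indicator [ std L ]
  V = combination ms
  top : ∑ P (λ ρ → χ ρ *ℤ μ₁ ρ) ≡ μ₁ (std L)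
  top = trans (∑-indicator μ₁ (patterns-unique L) ([] ∷ []) λ { (here refl) → ≼⇒∈-patterns (≼-refl {L}) }) (ℤ.+-identityʳ _)
  -- At `std L` the combination is 0 and `χ` is 1. Elsewhere `χ` is 0, and either `μ₁ ρ` is 0 or the
  -- combination is 1.
  pointwise : ∀ {ρ} → ρ ∈ P → μ₁ ρ ≡ χ ρ *ℤ μ₁ ρ +ℤ V ρ *ℤ μ₁ ρ
  pointwise {ρ} ρ∈ with ∈-patterns⇒≼ ρ∈ | ρ ≟L std L
  ... | _ | yes refl rewrite combination-top {L} ms minors = sym (trans (cong₂ _+ℤ_ (ℤ.*-identityˡ (μ₁ ρ)) (ℤ.*-zeroˡ (μ₁ ρ))) (ℤ.+-identityʳ (μ₁ ρ)))
  ... | ρ≼ , sρ | no ne with cover ρ ρ≼ sρ (≼-strict ρ≼ (ne ∘ trans (sym sρ)))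
  ...   | inj₁ z rewrite z = sym (trans (cong (0ℤ +ℤ_) (ℤ.*-zeroʳ (V ρ))) refl)
  ...   | inj₂ o rewrite o = sym (trans (cong (0ℤ +ℤ_) (ℤ.*-identityˡ (μ₁ ρ))) (ℤ.+-identityˡ (μ₁ ρ)))

-- Thinning two disjoint intervals

Outside⇒∉ : ∀ {w c} → Outside w c → ¬ c ∈ w
Outside⇒∉ (inj₁ lo) c∈ = ℕ.<-irrefl refl (lo c∈)
Outside⇒∉ (inj₂ hi) c∈ = ℕ.<-irrefl refl (hi c∈)

-- The map `G` is the isomorphism `k` on `u` and the identity elsewhere. It is monotone because `u`
-- and its image both lie in `w`, whose values no outer entry separates.
std-replace : ∀ {X w Z u u′} → Block X w Z → u ⊆ w → u′ ⊆ w → std u ≡ std u′ → std (X ++ u ++ Z) ≡ std (X ++ u′ ++ Z)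
std-replace {X} {w} {Z} {u} {u′} (bX , bZ) u⊆ u′⊆ eq with std≡⇒iso u u′ eq
... | k , strict , refl = sym (trans (cong std (sym image)) (std-map (X ++ u ++ Z) G-strict))
  where
  G : ℕ → ℕ
  G x with x ∈ℕ? u
  ... | yes _ = k x
  ... | no _ = x

  G-in : ∀ {x} → x ∈ u → G x ≡ k x
  G-in {x} x∈ with x ∈ℕ? u
  ... | yes _ = refl
  ... | no x∉ = contradiction x∈ x∉

  G-out : ∀ {x} → Outside w x → G x ≡ x
  G-out {x} o with x ∈ℕ? u
  ... | yes x∈ = contradiction (lookup u⊆ x∈) (Outside⇒∉ o)
  ... | no _ = refl

  image : map G (X ++ u ++ Z) ≡ X ++ map k u ++ Z
  image = trans (map-++ G X (u ++ Z)) (cong₂ _++_ (map-id-local (All.tabulate (G-out ∘ bX)))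
    (trans (map-++ G u Z) (cong₂ _++_ (map-cong-local (All.tabulate G-in)) (map-id-local (All.tabulate (G-out ∘ bZ))))))

  part : ∀ {x} → x ∈ X ++ u ++ Z → x ∈ u ⊎ Outside w x
  part x∈ with ∈-++⁻ X x∈
  ... | inj₁ x∈X = inj₂ (bX x∈X)
  ... | inj₂ x∈′ = Sum.map₂ bZ (∈-++⁻ u x∈′)

  k-in : ∀ {x} → x ∈ u → k x ∈ w
  k-in = lookup u′⊆ ∘ ∈-map⁺ k

  G-strict : StrictOn G (X ++ u ++ Z)
  G-strict x∈ y∈ x<y with part x∈ | part y∈
  ... | inj₁ x∈u | inj₁ y∈u rewrite G-in x∈u | G-in y∈u = strict x∈u y∈u x<y
  ... | inj₂ ox | inj₂ oy rewrite G-out ox | G-out oy = x<y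
  ... | inj₁ x∈u | inj₂ oy rewrite G-in x∈u | G-out oy with oy
  ...   | inj₁ lo = contradiction (lo (lookup u⊆ x∈u)) (ℕ.<-asym x<y)
  ...   | inj₂ hi = hi (k-in x∈u)
  G-strict x∈ y∈ x<y | inj₂ ox | inj₁ y∈u rewrite G-out ox | G-in y∈u with ox
  ...   | inj₁ lo = lo (k-in y∈u)
  ...   | inj₂ hi = contradiction (hi (lookup u⊆ y∈u)) (ℕ.<-asym x<y)

-- `fill p′ q′` is what remains of `L = fill p q` when its two disjoint intervals
-- order-isomorphic to `p` and `q` are thinned out to the entries named by `p′ ⊆ p` and `q′ ⊆ q`.
record Frame (p q L : List ℕ) : Set where
  field
    fill : List ℕ → List ℕ → List ℕ
    extra : ℕ
    fill-full : fill p q ≡ L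
    fill-length : ∀ p′ q′ → length (fill p′ q′) ≡ extra + (length p′ + length q′)
    fill-mono : ∀ {p′ p″ q′ q″} → p′ ⊆ p″ → q′ ⊆ q″ → fill p′ q′ ⊆ fill p″ q″
    fill-std : ∀ {p′ p″ q′ q″} → p′ ⊆ p → p″ ⊆ p → q′ ⊆ q → q″ ⊆ q → std p′ ≡ std p″ → std q′ ≡ std q″ →
               std (fill p′ q′) ≡ std (fill p″ q″)
    fill-⊆⁻ : ∀ {p′ q′ s} → p′ ⊆ p → q′ ⊆ q → s ⊆ fill p′ q′ →
              ∃₂ λ p″ q″ → p″ ⊆ p′ × q″ ⊆ q′ × s ⊆ fill p″ q″ × Interval p″ s × Interval q″ s

Frame-swap : ∀ {p q L} → Frame p q L → Frame q p L
Frame-swap F = record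
  { fill = λ p′ q′ → fill q′ p′
  ; extra = extra
  ; fill-full = fill-full
  ; fill-length = λ p′ q′ → trans (fill-length q′ p′) (cong (extra +_) (ℕ.+-comm (length q′) (length p′)))
  ; fill-mono = λ s t → fill-mono t s
  ; fill-std = λ a b c d e f → fill-std c d a b f e
  ; fill-⊆⁻ = λ a b s → case fill-⊆⁻ b a s of λ { (p″ , q″ , c , d , e , f , g) → q″ , p″ , d , c , e , g , f }
  }
  where open Frame F

++-assoc₃ : ∀ (X u Y W : List ℕ) → (X ++ u ++ Y) ++ W ≡ X ++ u ++ Y ++ W
++-assoc₃ X u Y W = trans (++-assoc X (u ++ Y) W) (cong (X ++_) (++-assoc u Y W))

-- The isomorphisms `f` and `h` name the entries of the two blocks by entries of `p` and `q`, so
-- thinning a block means mapping a sublist of its pattern.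
frame : ∀ {p q} X u Y v Z → std u ≡ std p → std v ≡ std q →
        Block X u (Y ++ v ++ Z) → Block (X ++ u ++ Y) v Z → Frame p q (X ++ u ++ Y ++ v ++ Z)
frame {p} {q} X u Y v Z su sv bu bv with std≡⇒iso p u (sym su) | std≡⇒iso q v (sym sv)
... | f , f-strict , refl | h , h-strict , refl = record
  { fill = fill
  ; extra = length X + (length Y + length Z)
  ; fill-full = refl
  ; fill-length = fill-length
  ; fill-mono = fill-mono
  ; fill-std = fill-std
  ; fill-⊆⁻ = fill-⊆⁻
  }
  where
  fill : List ℕ → List ℕ → List ℕ
  fill p′ q′ = X ++ map f p′ ++ Y ++ map h q′ ++ Z

  fill-length : ∀ p′ q′ → length (fill p′ q′) ≡ length X + (length Y + length Z) + (length p′ + length q′)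
  fill-length p′ q′
    rewrite length-++ X {map f p′ ++ Y ++ map h q′ ++ Z} | length-++ (map f p′) {Y ++ map h q′ ++ Z}
          | length-++ Y {map h q′ ++ Z} | length-++ (map h q′) {Z} | length-map f p′ | length-map h q′
    = rearrange (length X) (length p′) (length Y) (length q′) (length Z)
    where
    rearrange : ∀ a b c d e → a + (b + (c + (d + e))) ≡ a + (c + e) + (b + d)
    rearrange = ℕ-solve-∀

  fill-mono : ∀ {p′ p″ q′ q″} → p′ ⊆ p″ → q′ ⊆ q″ → fill p′ q′ ⊆ fill p″ q″
  fill-mono s t = Sub.++⁺ {as = X} ⊆-refl (Sub.++⁺ (Sub.map⁺ f s) (Sub.++⁺ {as = Y} ⊆-refl (Sub.++⁺ (Sub.map⁺ h t) ⊆-refl)))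

  std-f : ∀ {p′} → p′ ⊆ p → std (map f p′) ≡ std p′
  std-f s = std-map _ (StrictOn-⊆ s f-strict)

  std-h : ∀ {q′} → q′ ⊆ q → std (map h q′) ≡ std q′
  std-h s = std-map _ (StrictOn-⊆ s h-strict)

  fill-std : ∀ {p′ p″ q′ q″} → p′ ⊆ p → p″ ⊆ p → q′ ⊆ q → q″ ⊆ q → std p′ ≡ std p″ → std q′ ≡ std q″ →
             std (fill p′ q′) ≡ std (fill p″ q″)
  -- One block is replaced at a time; the reassociation presents the second block as the middle
  -- segment.
  fill-std {p′} {p″} {q′} {q″} p′⊆ p″⊆ q′⊆ q″⊆ eqp eqq = trans
    (std-replace (Block-⊆ {X} ⊆-refl ⊆-refl (Sub.++⁺ {as = Y} ⊆-refl (Sub.++⁺ (Sub.map⁺ h q′⊆) ⊆-refl)) bu)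
      (Sub.map⁺ f p′⊆) (Sub.map⁺ f p″⊆) (trans (std-f p′⊆) (trans eqp (sym (std-f p″⊆)))))
    (begin
      std (fill p″ q′)                                ≡⟨ cong std (++-assoc₃ X (map f p″) Y (map h q′ ++ Z)) ⟨
      std ((X ++ map f p″ ++ Y) ++ map h q′ ++ Z)     ≡⟨ std-replace (Block-⊆ (Sub.++⁺ {as = X} ⊆-refl (Sub.++⁺ (Sub.map⁺ f p″⊆) ⊆-refl)) ⊆-refl ⊆-refl bv)
                                                            (Sub.map⁺ h q′⊆) (Sub.map⁺ h q″⊆) (trans (std-h q′⊆) (trans eqq (sym (std-h q″⊆)))) ⟩
      std ((X ++ map f p″ ++ Y) ++ map h q″ ++ Z)     ≡⟨ cong std (++-assoc₃ X (map f p″) Y (map h q″ ++ Z)) ⟩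
      std (fill p″ q″)                                ∎)
    where open ≡-Reasoning

  fill-⊆⁻ : ∀ {p′ q′ s} → p′ ⊆ p → q′ ⊆ q → s ⊆ fill p′ q′ →
            ∃₂ λ p″ q″ → p″ ⊆ p′ × q″ ⊆ q′ × s ⊆ fill p″ q″ × Interval p″ s × Interval q″ s
  fill-⊆⁻ {p′} {q′} p′⊆ q′⊆ s⊆ with ⊆-++⁻ X s⊆
  ... | X′ , _ , refl , X′⊆ , s⊆₁ with ⊆-++⁻ (map f p′) s⊆₁
  ... | _ , _ , refl , u⊆ , s⊆₂ with ⊆-map⁻ p′ u⊆ | ⊆-++⁻ Y s⊆₂
  ... | p″ , refl , p″⊆ | Y′ , _ , refl , Y′⊆ , s⊆₃ with ⊆-++⁻ (map h q′) s⊆₃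
  ... | _ , Z′ , refl , v⊆ , Z′⊆ with ⊆-map⁻ q′ v⊆
  ... | q″ , refl , q″⊆ = p″ , q″ , p″⊆ , q″⊆
    , Sub.++⁺ X′⊆ (Sub.++⁺ {as = map f p″} ⊆-refl (Sub.++⁺ Y′⊆ (Sub.++⁺ {as = map h q″} ⊆-refl Z′⊆)))
    , interval {before = X′} refl (std-f p″⊆p) (Block-⊆ X′⊆ (Sub.map⁺ f p″⊆p) (Sub.++⁺ Y′⊆ (Sub.++⁺ (Sub.map⁺ h q″⊆q) Z′⊆)) bu)
    , interval {before = X′ ++ map f p″ ++ Y′} (sym (++-assoc₃ X′ (map f p″) Y′ (map h q″ ++ Z′))) (std-h q″⊆q)
        (Block-⊆ (Sub.++⁺ X′⊆ (Sub.++⁺ (Sub.map⁺ f p″⊆p) Y′⊆)) (Sub.map⁺ h q″⊆q) Z′⊆ bv)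
    where
    p″⊆p = ⊆-trans p″⊆ p′⊆
    q″⊆q = ⊆-trans q″⊆ q′⊆

-- The second interval is an empty block at the very end, for which the outside conditions are
-- vacuous.
frame-single : ∀ {p L} → Interval p L → Frame p [] L
frame-single (interval {X} {w} {Z} refl sw (bX , bZ)) =
  subst (Frame _ []) (cong (λ t → X ++ w ++ t) (++-identityʳ Z))
    (frame X w Z [] [] sw refl (bX , subst (λ t → ∀ {c} → c ∈ t → Outside w c) (sym (++-identityʳ Z)) bZ)
      ((λ _ → inj₁ λ ()) , λ ()))

-- Two splittings of one list in which `u` ends before `v` begins. As an indexed family, matching on
-- it identifies both splittings at once.
data Apart : (X₁ u Z₁ X₂ v Z₂ : List ℕ) → Set where
  apart : ∀ {X u Y v Z} → Apart X u (Y ++ v ++ Z) (X ++ u ++ Y) v Z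

frame-apart : ∀ {p q X₁ u Z₁ X₂ v Z₂} → Apart X₁ u Z₁ X₂ v Z₂ → std u ≡ std p → std v ≡ std q →
              Block X₁ u Z₁ → Block X₂ v Z₂ → Frame p q (X₁ ++ u ++ Z₁)
frame-apart (apart {X} {u} {Y} {v} {Z}) = frame X u Y v Z

-- `K` is the offset between the starts of two blocks; its length decides whether and how they
-- overlap.
prefix-compare : ∀ (X₁ X₂ : List ℕ) {A₁ A₂} → X₁ ++ A₁ ≡ X₂ ++ A₂ →
                 (∃ λ K → X₂ ≡ X₁ ++ K × A₁ ≡ K ++ A₂) ⊎ (∃ λ K → X₁ ≡ X₂ ++ K × A₂ ≡ K ++ A₁)
prefix-compare [] X₂ eq = inj₁ (X₂ , refl , eq)
prefix-compare (x ∷ X₁) [] eq = inj₂ (x ∷ X₁ , refl , sym eq)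
prefix-compare (x ∷ X₁) (y ∷ X₂) eq with ∷-injective eq
... | refl , eq′ with prefix-compare X₁ X₂ eq′
...   | inj₁ (K , refl , e) = inj₁ (K , refl , e)
...   | inj₂ (K , refl , e) = inj₂ (K , refl , e)

-- An outside entry cannot separate the values of a block. This refutes most overlaps below.
squeeze-up : ∀ {w c x y} → Outside w c → x ∈ w → y ∈ w → x < c → y < c
squeeze-up (inj₁ lo) x∈ _ x<c = contradiction (lo x∈) (ℕ.<-asym x<c)
squeeze-up (inj₂ hi) _ y∈ _ = hi y∈

squeeze-down : ∀ {w c x y} → Outside w c → x ∈ w → y ∈ w → c < x → c < y
squeeze-down (inj₁ lo) _ y∈ _ = lo y∈
squeeze-down (inj₂ hi) x∈ _ c<x = contradiction (hi x∈) (ℕ.<-asym c<x)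

pattern 0th = here refl
pattern 1st = there (here refl)
pattern 2nd = there (there (here refl))
pattern 3rd = there (there (there (here refl)))

-- At offset 0 the two orders conflict. At offset 1 each unshared entry is forced beyond the other,
-- on the same side of the shared entry.
apart-12-21 : ∀ {a b c d} X₁ Z₁ X₂ Z₂ → let u = a ∷ b ∷ [] ; v = c ∷ d ∷ [] in a < b → d < c → Block X₁ u Z₁ → Block X₂ v Z₂ →
              X₁ ++ u ++ Z₁ ≡ X₂ ++ v ++ Z₂ → Apart X₁ u Z₁ X₂ v Z₂ ⊎ Apart X₂ v Z₂ X₁ u Z₁
apart-12-21 X₁ Z₁ X₂ Z₂ a<b d<c (bX₁ , bZ₁) (bX₂ , bZ₂) eq with prefix-compare X₁ X₂ eq
... | inj₁ ([] , refl , refl) = contradiction a<b (ℕ.<-asym d<c)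
... | inj₁ (k ∷ [] , refl , refl) = contradiction (squeeze-down (bZ₁ 0th) 1st 0th d<c)
        (ℕ.<-asym (squeeze-down (bX₂ (∈-++⁺ʳ X₁ 0th)) 0th 1st a<b))
... | inj₁ (_ ∷ _ ∷ K , refl , refl) = inj₁ apart
... | inj₂ ([] , refl , refl) = contradiction a<b (ℕ.<-asym d<c)
... | inj₂ (k ∷ [] , refl , refl) = contradiction (squeeze-up (bZ₂ 0th) 1st 0th a<b)
        (ℕ.<-asym (squeeze-up (bX₁ (∈-++⁺ʳ X₂ 0th)) 0th 1st d<c))
... | inj₂ (_ ∷ _ ∷ K , refl , refl) = inj₂ apart

-- For every overlapping offset, either the shared entries are ordered differently by the two
-- patterns, or the unshared entries, lying outside the opposite interval, are forced into
-- contradictory comparisons.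
apart-213-2431 : ∀ {a b c d e f g} X₁ Z₁ X₂ Z₂ → let u = b ∷ a ∷ c ∷ [] ; v = e ∷ g ∷ f ∷ d ∷ [] in
                 a < b → b < c → d < e → e < f → f < g → Block X₁ u Z₁ → Block X₂ v Z₂ →
                 X₁ ++ u ++ Z₁ ≡ X₂ ++ v ++ Z₂ → Apart X₁ u Z₁ X₂ v Z₂ ⊎ Apart X₂ v Z₂ X₁ u Z₁
apart-213-2431 X₁ Z₁ X₂ Z₂ a<b b<c d<e e<f f<g (bX₁ , bZ₁) (bX₂ , bZ₂) eq with prefix-compare X₁ X₂ eq
... | inj₁ ([] , refl , refl) = contradiction a<b (ℕ.<-asym (ℕ.<-trans e<f f<g))
... | inj₁ (_ ∷ [] , refl , refl) = contradiction (squeeze-up (bZ₁ 0th) 1st 2nd e<f) (ℕ.<-asym f<g)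
... | inj₁ (_ ∷ _ ∷ [] , refl , refl) = contradiction (squeeze-down (bX₂ (∈-++⁺ʳ X₁ 0th)) 0th 3rd b<c)
        (ℕ.<-asym (squeeze-down (bZ₁ 2nd) 2nd 0th d<e))
... | inj₁ (_ ∷ _ ∷ _ ∷ K , refl , refl) = inj₁ apart
... | inj₂ ([] , refl , refl) = contradiction a<b (ℕ.<-asym (ℕ.<-trans e<f f<g))
... | inj₂ (_ ∷ [] , refl , refl) = contradiction b<c (ℕ.<-asym (ℕ.<-trans (ℕ.<-trans d<e e<f) f<g))
... | inj₂ (_ ∷ _ ∷ [] , refl , refl) = contradiction (squeeze-up (bX₁ (∈-++⁺ʳ X₂ 0th)) 1st 0th d<e) (ℕ.<-asym e<f)
... | inj₂ (_ ∷ _ ∷ _ ∷ [] , refl , refl) = contradiction (squeeze-up (bX₁ (∈-++⁺ʳ X₂ 0th)) 0th 2nd d<e)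
        (ℕ.<-asym (squeeze-up (bZ₂ 1st) 3rd 0th b<c))
... | inj₂ (_ ∷ _ ∷ _ ∷ _ ∷ K , refl , refl) = inj₂ apart

frame-12-21 : ∀ {L} → Interval (1 ∷ 2 ∷ []) L → Interval (2 ∷ 1 ∷ []) L → Frame (1 ∷ 2 ∷ []) (2 ∷ 1 ∷ []) L
frame-12-21 (interval {X₁} {u} {Z₁} refl su bu) (interval {X₂} {v} {Z₂} eq sv bv)
  with std≡⇒iso (1 ∷ 2 ∷ []) u (sym su) | std≡⇒iso (2 ∷ 1 ∷ []) v (sym sv)
... | f , f-strict , refl | h , h-strict , refl
  with apart-12-21 X₁ Z₁ X₂ Z₂ (f-strict 0th 1st (s≤s (s≤s z≤n))) (h-strict 1st 0th (s≤s (s≤s z≤n))) bu bv eq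
... | inj₁ ap = frame-apart ap su sv bu bv
-- The descent comes first here, so the frame is built on the other splitting, then swapped and
-- transported.
... | inj₂ ap = subst (Frame _ _) (sym eq) (Frame-swap (frame-apart ap sv su bv bu))

frame-213-2431 : ∀ {L} → Interval (2 ∷ 1 ∷ 3 ∷ []) L → Interval (2 ∷ 4 ∷ 3 ∷ 1 ∷ []) L → Frame (2 ∷ 1 ∷ 3 ∷ []) (2 ∷ 4 ∷ 3 ∷ 1 ∷ []) L
frame-213-2431 (interval {X₁} {u} {Z₁} refl su bu) (interval {X₂} {v} {Z₂} eq sv bv)
  with std≡⇒iso (2 ∷ 1 ∷ 3 ∷ []) u (sym su) | std≡⇒iso (2 ∷ 4 ∷ 3 ∷ 1 ∷ []) v (sym sv)
... | f , f-strict , refl | h , h-strict , refl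
  with apart-213-2431 X₁ Z₁ X₂ Z₂ (f-strict 1st 0th ℕ.≤-refl) (f-strict 0th 2nd ℕ.≤-refl)
         (h-strict 3rd 0th ℕ.≤-refl) (h-strict 0th 2nd ℕ.≤-refl) (h-strict 2nd 1st ℕ.≤-refl) bu bv eq
... | inj₁ ap = frame-apart ap su sv bu bv
... | inj₂ ap = subst (Frame _ _) (sym eq) (Frame-swap (frame-apart ap sv su bv bu))

-- Vanishing criteria

p12 p21 p213 p132 p231 p321 p2431 : List ℕ
p12 = 1 ∷ 2 ∷ []
p21 = 2 ∷ 1 ∷ []
p213 = 2 ∷ 1 ∷ 3 ∷ []
p132 = 1 ∷ 3 ∷ 2 ∷ []
p231 = 2 ∷ 3 ∷ 1 ∷ []
p321 = 3 ∷ 2 ∷ 1 ∷ []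
p2431 = 2 ∷ 4 ∷ 3 ∷ 1 ∷ []

outside? : ∀ w c → Dec (All (c <_) w ⊎ All (_< c) w)
outside? w c = all? (c <?_) w ⊎-dec all? (_<? c) w

concrete-interval : ∀ {p} X w Z → {True (all? (outside? w) X)} → {True (all? (outside? w) Z)} → std w ≡ std p → Interval p (X ++ w ++ Z)
concrete-interval X w Z {oX} {oZ} eq = interval {before = X} refl eq (outside oX , outside oZ)
  where
  outside : ∀ {Y} → True (all? (outside? w) Y) → ∀ {c} → c ∈ Y → Outside w c
  outside t c∈ = Sum.map (λ lo → All.lookup lo) (λ hi → All.lookup hi) (All.lookup (toWitness t) c∈)

-- Together these are all sub-patterns of `213` and `2431` of length at least 2, sorted by the kind
-- of interval of length 2 they contain.
ascents descents : List (List ℕ)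
ascents = p12 ∷ p231 ∷ []
descents = p21 ∷ p213 ∷ p132 ∷ p321 ∷ p2431 ∷ []

descent-intervals : All (Interval p21) descents
descent-intervals = concrete-interval [] p21 [] refl
  ∷ concrete-interval [] (2 ∷ 1 ∷ []) (3 ∷ []) refl
  ∷ concrete-interval (1 ∷ []) (3 ∷ 2 ∷ []) [] refl
  ∷ concrete-interval [] (3 ∷ 2 ∷ []) (1 ∷ []) refl
  ∷ concrete-interval (2 ∷ []) (4 ∷ 3 ∷ []) (1 ∷ []) refl
  ∷ []

ascent-intervals : All (Interval p12) ascents
ascent-intervals = concrete-interval [] p12 [] refl
  ∷ concrete-interval [] (2 ∷ 3 ∷ []) (1 ∷ []) refl
  ∷ []

-- Comparing ideals of thinned frames

Avoids : List (List ℕ) → List ℕ → Set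
Avoids ks ρ = All (λ k → ¬ Interval k ρ) ks

avoids : ∀ {a ks ρ} → All (Interval a) ks → ¬ Interval a ρ → Avoids ks ρ
avoids is ¬a = All.map (λ i → ¬a ∘ Interval-trans i) is

-- Thinning a block from `p` to `r` loses only the occurrences that use a pattern from `ks` in it.
-- The condition is finite, so each instance is settled by evaluation.
Confined : List (List ℕ) → List ℕ → List ℕ → Set
Confined ks p r = All (λ t → std t ∈ ks ++ patterns r) (subseqs p)

confined? : ∀ ks p r → Dec (Confined ks p r)
confined? ks p r = all? (λ t → std t ∈? ks ++ patterns r) (subseqs p)

confined : ∀ {ks p r t} → Confined ks p r → t ⊆ p → std t ∈ ks ⊎ t ≼ r
confined {ks} {p} {r} {t} c t⊆ = Sum.map₂ dominated (∈-++⁻ ks (All.lookup c (⊆⇒∈-subseqs t⊆)))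
  where
  dominated : std t ∈ patterns r → t ≼ r
  dominated st∈ with ∈-patterns⇒≼ {L = r} st∈
  ... | (w , w⊆ , eq) , _ = w , w⊆ , trans eq (std-idem t)

module Ideals {p q L} (F : Frame p q L) (ρ : List ℕ) where
  open Frame F public

  At : List ℕ → List ℕ → Set
  At a b = ρ ≼ fill a b

  -- An occurrence of ρ in `fill a b` either lies in `fill c d` up to order isomorphism, or
  -- makes an interval of ρ out of one of the patterns `ks`.
  retract : ∀ ks a b c d → {True (a ⊆? p)} → {True (b ⊆? q)} → {True (c ⊆? p)} → {True (d ⊆? q)} →
            {True (confined? ks a c)} → {True (confined? ks b d)} →
            At a b → Any (λ k → Interval k ρ) ks ⊎ At c d
  retract ks a b c d {a⊆} {b⊆} {c⊆} {d⊆} {ac} {bd} (t , t⊆ , eq) with fill-⊆⁻ (toWitness a⊆) (toWitness b⊆) t⊆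
  ... | a′ , b′ , a′⊆ , b′⊆ , t⊆′ , ia , ib
    with confined (toWitness {a? = confined? ks a c} ac) a′⊆ | confined (toWitness {a? = confined? ks b d} bd) b′⊆
  ... | inj₁ k∈ | _ = inj₁ (lose k∈ (Interval-resp-pattern (sym (std-idem a′)) (Interval-resp-std eq ia)))
  ... | inj₂ _ | inj₁ k∈ = inj₁ (lose k∈ (Interval-resp-pattern (sym (std-idem b′)) (Interval-resp-std eq ib)))
  ... | inj₂ (a″ , a″⊆ , ea) | inj₂ (b″ , b″⊆ , eb) = inj₂ (≼-trans (t , t⊆′ , eq)
      (fill a″ b″ , fill-mono a″⊆ b″⊆ ,
       fill-std (⊆-trans a″⊆ (toWitness c⊆)) (⊆-trans a′⊆ (toWitness a⊆)) (⊆-trans b″⊆ (toWitness d⊆)) (⊆-trans b′⊆ (toWitness b⊆)) ea eb))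

  retract-avoiding : ∀ {ks} → Avoids ks ρ → ∀ a b c d → {True (a ⊆? p)} → {True (b ⊆? q)} → {True (c ⊆? p)} → {True (d ⊆? q)} →
                     {True (confined? ks a c)} → {True (confined? ks b d)} → At a b → At c d
  retract-avoiding {ks} av a b c d {a⊆} {b⊆} {c⊆} {d⊆} {ac} {bd} at with retract ks a b c d {a⊆} {b⊆} {c⊆} {d⊆} {ac} {bd} at
  ... | inj₁ k = ⊥-elim (All.All¬⇒¬Any av k)
  ... | inj₂ at′ = at′

  -- With no exceptional patterns, confinement says that `a` is a pattern of `c` and `b` of `d`.
  enlarge : ∀ a b c d → {True (a ⊆? p)} → {True (b ⊆? q)} → {True (c ⊆? p)} → {True (d ⊆? q)} →
            {True (confined? [] a c)} → {True (confined? [] b d)} → At a b → At c d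
  enlarge = retract-avoiding []

  ind : List ℕ → List ℕ → ℤ
  ind a b = indicator (patterns (fill a b)) ρ

  module _ (sρ : std ρ ≡ ρ) where
    At⇒ind : ∀ a b → At a b → ind a b ≡ 1ℤ
    At⇒ind a b at = ∈⇒indicator (subst (_∈ patterns (fill a b)) sρ (≼⇒∈-patterns at))

    ind-cong : ∀ a b c d → (At a b → At c d) → (At c d → At a b) → ind a b ≡ ind c d
    ind-cong a b c d to from with ρ ∈? patterns (fill c d)
    ... | yes ρ∈ = At⇒ind a b (from (proj₁ (∈-patterns⇒≼ {L = fill c d} ρ∈)))
    ... | no ρ∉ = ∉⇒indicator λ ρ∈ → ρ∉ (subst (_∈ patterns (fill c d)) sρ (≼⇒∈-patterns (to (proj₁ (∈-patterns⇒≼ {L = fill a b} ρ∈)))))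

-- The counterpart of `Minor` inside a frame. The lower bound 2 rules out length one, however few
-- entries lie outside the blocks.
ThinnedBlocks : List ℕ → List ℕ → ℤ × List ℕ × List ℕ → Set
ThinnedBlocks p q (_ , a , b) = a ⊆ p × b ⊆ q × length a + length b < length p + length q × 2 ≤ length a + length b

thinnedBlocks? : ∀ p q m → Dec (ThinnedBlocks p q m)
thinnedBlocks? p q (_ , a , b) = a ⊆? p ×-dec b ⊆? q ×-dec length a + length b <? length p + length q ×-dec 2 ≤? length a + length b

-- The combination is evaluated only where `μ₁ ρ` is nonzero; there the vanishing criteria, read
-- contrapositively through `nonzero⇒¬`, forbid intervals in `ρ`.
frame-vanishing : ∀ {p q L} (F : Frame p q L) (ms : List (ℤ × List ℕ × List ℕ)) →
                  {True (all? (thinnedBlocks? p q) ms)} → {True (2 ≤? length p + length q)} →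
                  (let open Frame F) →
                  (∀ ρ → ρ ≼ fill p q → std ρ ≡ ρ → length ρ < length L → μ₁ ρ ≢ 0ℤ →
                    combination (map (λ (k , a , b) → k , fill a b) ms) ρ ≡ 1ℤ) →
                  μ₁ (std L) ≡ 0ℤ
frame-vanishing {p} {q} {L} F ms {thin} {two} cover = vanishing L length≢1 _ (All.map⁺ (All.map (λ {m} → minor {m}) (toWitness thin))) cover′
  where
  open Frame F
  length-L : length L ≡ extra + (length p + length q)
  length-L = trans (cong length (sym fill-full)) (fill-length p q)
  large≢1 : ∀ {n} → 2 ≤ n → extra + n ≢ 1
  large≢1 2≤n eq = ℕ.<⇒≢ (ℕ.≤-trans 2≤n (ℕ.m≤n+m _ extra)) (sym eq)
  length≢1 : length L ≢ 1
  length≢1 eq = large≢1 (toWitness two) (trans (sym length-L) eq)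
  minor : ∀ {m} → ThinnedBlocks p q m → Minor L (fill (proj₁ (proj₂ m)) (proj₂ (proj₂ m)))
  minor {_ , a , b} (a⊆ , b⊆ , lt , 2≤) =
    subst (fill a b ⊆_) fill-full (fill-mono a⊆ b⊆)
    , subst₂ _<_ (sym (fill-length a b)) (sym length-L) (ℕ.+-monoʳ-< extra lt)
    , λ eq → large≢1 2≤ (trans (sym (fill-length a b)) eq)
  cover′ : ∀ ρ → ρ ≼ L → std ρ ≡ ρ → length ρ < length L → μ₁ ρ ≡ 0ℤ ⊎ _ ≡ 1ℤ
  cover′ ρ ρ≼ sρ lt with μ₁ ρ ℤ.≟ 0ℤ
  ... | yes z = inj₁ z
  ... | no nz = inj₂ (cover ρ (subst (ρ ≼_) (sym fill-full) ρ≼) sρ lt nz)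

-- The two auxiliary vanishing results

nonzero⇒¬ : ∀ {ρ} {P : Set} → std ρ ≡ ρ → μ₁ ρ ≢ 0ℤ → (P → μ₁ (std ρ) ≡ 0ℤ) → ¬ P
nonzero⇒¬ sρ nz kill p = nz (trans (cong μ₁ (sym sρ)) (kill p))

-- Every proper sub-pattern of `321` is contained in `21`. By induction on length a relevant `ρ` has
-- no interval `321`, so it lies in the single ideal thinned to `21`.
interval-321-vanishes : ∀ {L} → Interval p321 L → μ₁ (std L) ≡ 0ℤ
interval-321-vanishes {L} = go (suc (length L)) L ℕ.≤-refl
  where
  go : ∀ n L → length L < n → Interval p321 L → μ₁ (std L) ≡ 0ℤ
  go (suc n) L (s≤s le) i = frame-vanishing F ((1ℤ , p21 , []) ∷ []) cover
    where
    F = frame-single i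
    cover : ∀ ρ → _ → _ → _ → _ → _
    cover ρ at sρ lt nz = cong (λ z → 1ℤ *ℤ z +ℤ 0ℤ) (At⇒ind sρ p21 [] (retract-avoiding (¬321 ∷ []) p321 [] p21 [] at))
      where
      open Ideals F ρ
      ¬321 : ¬ Interval p321 ρ
      ¬321 = nonzero⇒¬ {ρ} sρ nz (go n ρ (ℕ.<-≤-trans lt le))

-- The combination is the inclusion-exclusion [12,1] + [1,21] - [1,1]. By induction on length a
-- relevant `ρ` has not both kinds of interval, so it lies in one of the first two ideals, and in
-- the other iff it lies in [1,1].
ascent-descent-vanishes : ∀ {L} → Interval p12 L → Interval p21 L → μ₁ (std L) ≡ 0ℤ
ascent-descent-vanishes {L} = go (suc (length L)) L ℕ.≤-refl
  where
  value : ∀ {a b c} → a ≡ 1ℤ × b ≡ c ⊎ b ≡ 1ℤ × a ≡ c → 1ℤ *ℤ a +ℤ (1ℤ *ℤ b +ℤ (-1ℤ *ℤ c +ℤ 0ℤ)) ≡ 1ℤ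
  value {b = b} (inj₁ (refl , refl)) = lemma b
    where
    lemma : ∀ b → 1ℤ *ℤ 1ℤ +ℤ (1ℤ *ℤ b +ℤ (-1ℤ *ℤ b +ℤ 0ℤ)) ≡ 1ℤ
    lemma = solve-∀
  value {a} (inj₂ (refl , refl)) = lemma a
    where
    lemma : ∀ a → 1ℤ *ℤ a +ℤ (1ℤ *ℤ 1ℤ +ℤ (-1ℤ *ℤ a +ℤ 0ℤ)) ≡ 1ℤ
    lemma = solve-∀

  go : ∀ n L → length L < n → Interval p12 L → Interval p21 L → μ₁ (std L) ≡ 0ℤ
  go (suc n) L (s≤s le) i12 i21 = frame-vanishing F ((1ℤ , p12 , 1 ∷ []) ∷ (1ℤ , 1 ∷ [] , p21) ∷ (-1ℤ , 1 ∷ [] , 1 ∷ []) ∷ []) cover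
    where
    F = frame-12-21 i12 i21
    cover : ∀ ρ → _ → _ → _ → _ → _
    cover ρ at sρ lt nz = value cases
      where
      open Ideals F ρ
      ¬both : ¬ (Interval p12 ρ × Interval p21 ρ)
      ¬both = nonzero⇒¬ {ρ} sρ nz (λ (i , j) → go n ρ (ℕ.<-≤-trans lt le) i j)
      cases : ind p12 (1 ∷ []) ≡ 1ℤ × ind (1 ∷ []) p21 ≡ ind (1 ∷ []) (1 ∷ []) ⊎
              ind (1 ∷ []) p21 ≡ 1ℤ × ind p12 (1 ∷ []) ≡ ind (1 ∷ []) (1 ∷ [])
      -- Thinning `12` to a single entry fails only if it exhibits an ascending interval of `ρ`,
      -- which excludes descending ones; otherwise the same is tried with `21`.
      cases with retract (p12 ∷ []) p12 p21 (1 ∷ []) p21 at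
      ... | inj₁ (here i) = inj₁
        ( At⇒ind sρ _ _ (retract-avoiding ¬21 p12 p21 p12 (1 ∷ []) at)
        , ind-cong sρ _ _ _ _ (retract-avoiding ¬21 (1 ∷ []) p21 (1 ∷ []) (1 ∷ [])) (enlarge (1 ∷ []) (1 ∷ []) (1 ∷ []) p21))
        where
        ¬21 : Avoids (p21 ∷ []) ρ
        ¬21 = (λ j → ¬both (i , j)) ∷ []
      ... | inj₂ at₁ with retract (p21 ∷ []) (1 ∷ []) p21 (1 ∷ []) (1 ∷ []) at₁
      ...   | inj₁ (here j) = inj₂
        ( At⇒ind sρ _ _ at₁
        , ind-cong sρ _ _ _ _ (retract-avoiding ((λ i → ¬both (i , j)) ∷ []) p12 (1 ∷ []) (1 ∷ []) (1 ∷ [])) (enlarge (1 ∷ []) (1 ∷ []) p12 (1 ∷ [])))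
      ...   | inj₂ at₀ = inj₂
        ( At⇒ind sρ _ _ at₁
        , trans (At⇒ind sρ _ _ (enlarge (1 ∷ []) (1 ∷ []) p12 (1 ∷ []) at₀)) (sym (At⇒ind sρ _ _ at₀)))

-- The seven-term combination for `213` and `2431`

-- Sublists of 213 (`a`) and 2431 (`b`), named after the pattern they form.
a12 a1 b12 b231 b132 : List ℕ
a12 = 2 ∷ 3 ∷ []
a1 = 2 ∷ []
b12 = 2 ∷ 4 ∷ []
b231 = 2 ∷ 4 ∷ 1 ∷ []
b132 = 2 ∷ 4 ∷ 3 ∷ []

-- The last three hypotheses are the vanishing criteria, contraposed for a `ρ` with nonzero `μ₁`.
module Cover {L} (F : Frame p213 p2431 L) (ρ : List ℕ) (sρ : std ρ ≡ ρ)
             (¬321 : ¬ Interval p321 ρ) (¬both : Interval p12 ρ → ¬ Interval p21 ρ)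
             (¬pair : Interval p213 ρ → ¬ Interval p2431 ρ) where
  open Ideals F ρ

  -- The two ways for the combination to be 1. In the first, its first term is 1 and the rest cancel
  -- in pairs. In the second, the [12,·] and [1,·] terms cancel, one of the second and third terms
  -- is 1, and the other cancels [21,132].
  TrivialOrAscent DescentOnly : Set
  TrivialOrAscent = ind a12 b231 ≡ 1ℤ × ind p21 p2431 ≡ ind a1 b231 × ind p213 b132 ≡ ind a12 b12 × ind p21 b132 ≡ ind a1 b12
  DescentOnly = ind a12 b231 ≡ ind a1 b231 × ind a12 b12 ≡ ind a1 b12 ×
    (ind p21 p2431 ≡ 1ℤ × ind p213 b132 ≡ ind p21 b132 ⊎ ind p213 b132 ≡ 1ℤ × ind p21 p2431 ≡ ind p21 b132)

  trivial-case : At a1 a1 → TrivialOrAscent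
  trivial-case at₀ =
    At⇒ind sρ a12 b231 (enlarge a1 a1 a12 b231 at₀)
    , both p21 p2431 a1 b231 (enlarge a1 a1 p21 p2431 at₀) (enlarge a1 a1 a1 b231 at₀)
    , both p213 b132 a12 b12 (enlarge a1 a1 p213 b132 at₀) (enlarge a1 a1 a12 b12 at₀)
    , both p21 b132 a1 b12 (enlarge a1 a1 p21 b132 at₀) (enlarge a1 a1 a1 b12 at₀)
    where
    both : ∀ a b c d → At a b → At c d → ind a b ≡ ind c d
    both a b c d x y = trans (At⇒ind sρ a b x) (sym (At⇒ind sρ c d y))

  -- Without descending intervals, `213` and `21` thin to `12` and `1`, while `2431` and `132` thin
  -- to `231` and `12`.
  ascent-case : Interval p12 ρ → At p213 p2431 → TrivialOrAscent
  ascent-case i at =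
    At⇒ind sρ a12 b231 (retract-avoiding avoided p213 p2431 a12 b231 at)
    , ind-cong sρ p21 p2431 a1 b231 (retract-avoiding avoided p21 p2431 a1 b231) (enlarge a1 b231 p21 p2431)
    , ind-cong sρ p213 b132 a12 b12 (retract-avoiding avoided p213 b132 a12 b12) (enlarge a12 b12 p213 b132)
    , ind-cong sρ p21 b132 a1 b12 (retract-avoiding avoided p21 b132 a1 b12) (enlarge a1 b12 p21 b132)
    where
    avoided : Avoids descents ρ
    avoided = avoids descent-intervals (¬both i)

  -- Without ascending intervals `12` thins to `1`. Excluding `321` too, an occurrence that uses
  -- less than all of `2431` uses at most a `132` of it, and likewise `213` thins to `21`.
  descent-case : Interval p21 ρ → At p213 p2431 → DescentOnly
  descent-case j at =
    ind-cong sρ a12 b231 a1 b231 (retract-avoiding avoided a12 b231 a1 b231) (enlarge a1 b231 a12 b231)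
    , ind-cong sρ a12 b12 a1 b12 (retract-avoiding avoided a12 b12 a1 b12) (enlarge a1 b12 a12 b12)
    , tops (retract (p213 ∷ p321 ∷ ascents) p213 p2431 p21 p2431 at)
    where
    avoided : Avoids (p321 ∷ ascents) ρ
    avoided = ¬321 ∷ avoids ascent-intervals (λ i → ¬both i j)

    Tops : Set
    Tops = ind p21 p2431 ≡ 1ℤ × ind p213 b132 ≡ ind p21 b132 ⊎ ind p213 b132 ≡ 1ℤ × ind p21 p2431 ≡ ind p21 b132

    tops₁ : At p21 p2431 → Any (λ k → Interval k ρ) (p2431 ∷ p321 ∷ ascents) ⊎ At p21 b132 → Tops
    tops₁ at₁ (inj₁ (here y)) = inj₁
      ( At⇒ind sρ p21 p2431 at₁
      , ind-cong sρ p213 b132 p21 b132 (retract-avoiding ((λ x → ¬pair x y) ∷ avoided) p213 b132 p21 b132) (enlarge p21 b132 p213 b132))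
    tops₁ at₁ (inj₁ (there bad)) = ⊥-elim (All.All¬⇒¬Any avoided bad)
    -- Neither full block is used: `ρ` lies in [21,132], and hence in both larger ideals.
    tops₁ at₁ (inj₂ at₂) = inj₁
      ( At⇒ind sρ p21 p2431 at₁
      , ind-cong sρ p213 b132 p21 b132 (λ _ → at₂) (enlarge p21 b132 p213 b132))

    tops : Any (λ k → Interval k ρ) (p213 ∷ p321 ∷ ascents) ⊎ At p21 p2431 → Tops
    tops (inj₁ (here x)) = inj₂
      ( At⇒ind sρ p213 b132 (retract-avoiding (¬pair x ∷ avoided) p213 p2431 p213 b132 at)
      , ind-cong sρ p21 p2431 p21 b132 (retract-avoiding (¬pair x ∷ avoided) p21 p2431 p21 b132) (enlarge p21 b132 p21 p2431))
    tops (inj₁ (there bad)) = ⊥-elim (All.All¬⇒¬Any avoided bad)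
    tops (inj₂ at₁) = tops₁ at₁ (retract (p2431 ∷ p321 ∷ ascents) p21 p2431 p21 b132 at₁)

  sub-interval : ∀ {a ks} → All (Interval a) ks → Any (λ k → Interval k ρ) ks → Interval a ρ
  sub-interval (i ∷ _) (here x) = Interval-trans i x
  sub-interval (_ ∷ is) (there x) = sub-interval is x

  -- Thinning both blocks to one entry fails only if some longer sub-pattern becomes an interval of
  -- `ρ`, and each of these contains an ascent or a descent interval.
  cases : At p213 p2431 → TrivialOrAscent ⊎ DescentOnly
  cases at = by (retract (ascents ++ descents) p213 p2431 a1 a1 at)
    where
    by : Any (λ k → Interval k ρ) (ascents ++ descents) ⊎ At a1 a1 → TrivialOrAscent ⊎ DescentOnly
    by (inj₂ at₀) = inj₁ (trivial-case at₀)
    by (inj₁ k) = Sum.map (λ x → ascent-case (sub-interval ascent-intervals x) at)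
                          (λ x → descent-case (sub-interval descent-intervals x) at)
                          (Any.++⁻ ascents k)

interval-213-2431-vanishes : ∀ {L} → Interval p213 L → Interval p2431 L → μ₁ (std L) ≡ 0ℤ
interval-213-2431-vanishes {L} = go (suc (length L)) L ℕ.≤-refl
  where
  -- The letters stand for the seven indicators in the order in which the combination lists them.
  value : ∀ {a b c d e f g} →
          a ≡ 1ℤ × b ≡ d × c ≡ e × f ≡ g ⊎ a ≡ d × e ≡ g × (b ≡ 1ℤ × c ≡ f ⊎ c ≡ 1ℤ × b ≡ f) →
          1ℤ *ℤ a +ℤ (1ℤ *ℤ b +ℤ (1ℤ *ℤ c +ℤ (-1ℤ *ℤ d +ℤ (-1ℤ *ℤ e +ℤ (-1ℤ *ℤ f +ℤ (1ℤ *ℤ g +ℤ 0ℤ)))))) ≡ 1ℤ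
  value {b = b} {c = c} {f = f} (inj₁ (refl , refl , refl , refl)) = lemma b c f
    where
    lemma : ∀ b c f → 1ℤ *ℤ 1ℤ +ℤ (1ℤ *ℤ b +ℤ (1ℤ *ℤ c +ℤ (-1ℤ *ℤ b +ℤ (-1ℤ *ℤ c +ℤ (-1ℤ *ℤ f +ℤ (1ℤ *ℤ f +ℤ 0ℤ)))))) ≡ 1ℤ
    lemma = solve-∀
  value {a} {c = c} {e = e} (inj₂ (refl , refl , inj₁ (refl , refl))) = lemma a c e
    where
    lemma : ∀ a c e → 1ℤ *ℤ a +ℤ (1ℤ *ℤ 1ℤ +ℤ (1ℤ *ℤ c +ℤ (-1ℤ *ℤ a +ℤ (-1ℤ *ℤ e +ℤ (-1ℤ *ℤ c +ℤ (1ℤ *ℤ e +ℤ 0ℤ)))))) ≡ 1ℤ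
    lemma = solve-∀
  value {a} {b} {e = e} (inj₂ (refl , refl , inj₂ (refl , refl))) = lemma a b e
    where
    lemma : ∀ a b e → 1ℤ *ℤ a +ℤ (1ℤ *ℤ b +ℤ (1ℤ *ℤ 1ℤ +ℤ (-1ℤ *ℤ a +ℤ (-1ℤ *ℤ e +ℤ (-1ℤ *ℤ b +ℤ (1ℤ *ℤ e +ℤ 0ℤ)))))) ≡ 1ℤ
    lemma = solve-∀

  go : ∀ n L → length L < n → Interval p213 L → Interval p2431 L → μ₁ (std L) ≡ 0ℤ
  go (suc n) L (s≤s le) i j = frame-vanishing F
    ((1ℤ , a12 , b231) ∷ (1ℤ , p21 , p2431) ∷ (1ℤ , p213 , b132) ∷
     (-1ℤ , a1 , b231) ∷ (-1ℤ , a12 , b12) ∷ (-1ℤ , p21 , b132) ∷ (1ℤ , a1 , b12) ∷ [])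
    (λ ρ at sρ lt nz → value (Cover.cases F ρ sρ
      -- The first two exclusions come from the auxiliary results, the third from the induction
      -- hypothesis for the shorter `ρ`.
      (nonzero⇒¬ {ρ} sρ nz interval-321-vanishes)
      (λ x → nonzero⇒¬ {ρ} sρ nz (ascent-descent-vanishes x))
      (λ x → nonzero⇒¬ {ρ} sρ nz (go n ρ (ℕ.<-≤-trans lt le) x))
      at))
    where
    F = frame-213-2431 i j

-- Inflations

module Inflation (block : ℕ → List ℕ) (range : ∀ k → All (λ e → 1 ≤ e × e ≤ length (block k)) (block k)) where

  size : ℕ → ℕ
  size k = length (block k)

  -- Restates the local definition in `inflate` with the list of indexed entries as a parameter, so
  -- that induction over that list is possible.
  base : List (ℕ × ℕ) → ℕ → ℕ
  base is v = sum (map (λ { (l , w) → if w <ᵇ v then size l else 0 }) is)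

  piece : List (ℕ × ℕ) → ℕ × ℕ → List ℕ
  piece is (k , v) = map (base is v +_) (block k)

  term-mono : ∀ {v v′} l w → v ≤ v′ → (if w <ᵇ v then size l else 0) ≤ (if w <ᵇ v′ then size l else 0)
  term-mono {v} {v′} l w v≤v′ with w <ᵇ v in eq | w <ᵇ v′ in eq′
  ... | true | true = ℕ.≤-refl
  ... | false | _ = z≤n
  ... | true | false = contradiction
    (subst T eq′ (ℕ.<⇒<ᵇ (ℕ.<-≤-trans (ℕ.<ᵇ⇒< w v (subst T (sym eq) _)) v≤v′))) λ ()

  base-mono : ∀ {v v′} is → v ≤ v′ → base is v ≤ base is v′
  base-mono [] _ = z≤n
  base-mono ((l , w) ∷ is) v≤v′ = ℕ.+-mono-≤ (term-mono l w v≤v′) (base-mono is v≤v′)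

  -- The block at `k` contributes its size to the base of `v′` and nothing to that of `v`; all other
  -- contributions are monotone.
  base-gap : ∀ {k v v′} is → (k , v) ∈ is → v < v′ → base is v + size k ≤ base is v′
  base-gap {k} {v} {v′} ((_ , _) ∷ is) (here refl) v<v′ with v <ᵇ v in eq | v <ᵇ v′ in eq′
  ... | true | _ = contradiction (ℕ.<ᵇ⇒< v v (subst T (sym eq) _)) (ℕ.<-irrefl refl)
  ... | false | true = subst (_≤ size k + base is v′) (ℕ.+-comm (size k) (base is v)) (ℕ.+-monoʳ-≤ (size k) (base-mono is (ℕ.<⇒≤ v<v′)))
  ... | false | false = contradiction (subst T eq′ (ℕ.<⇒<ᵇ v<v′)) λ ()
  base-gap {k} {v} {v′} ((l , w) ∷ is) (there k∈) v<v′ =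
    subst (_≤ base ((l , w) ∷ is) v′) (sym (ℕ.+-assoc _ (base is v) (size k)))
      (ℕ.+-mono-≤ (term-mono l w (ℕ.<⇒≤ v<v′)) (base-gap is k∈ v<v′))

  piece-< : ∀ {is k v k′ v′ x y} → (k , v) ∈ is → v < v′ → x ∈ piece is (k , v) → y ∈ piece is (k′ , v′) → x < y
  piece-< {is} {k} {v} {k′} {v′} k∈ v<v′ x∈ y∈ with ∈-map⁻ (base is v +_) x∈ | ∈-map⁻ (base is v′ +_) y∈
  ... | e , e∈ , refl | e′ , e′∈ , refl = begin-strict
    base is v + e         ≤⟨ ℕ.+-monoʳ-≤ (base is v) (proj₂ (All.lookup (range k) e∈)) ⟩
    base is v + size k    ≤⟨ base-gap is k∈ v<v′ ⟩
    base is v′            <⟨ ℕ.m<m+n (base is v′) (proj₁ (All.lookup (range k′) e′∈)) ⟩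
    base is v′ + e′       ∎
    where open ℕ.≤-Reasoning

  piece-outside : ∀ {is k v k′ v′ c} → (k , v) ∈ is → (k′ , v′) ∈ is → v ≢ v′ → c ∈ piece is (k′ , v′) → Outside (piece is (k , v)) c
  piece-outside {v = v} {v′ = v′} k∈ k′∈ v≢ c∈ with ℕ.<-cmp v v′
  ... | tri< v<v′ _ _ = inj₂ λ e∈ → piece-< k∈ v<v′ e∈ c∈
  ... | tri≈ _ v≡v′ _ = contradiction v≡v′ v≢
  ... | tri> _ _ v′<v = inj₁ λ e∈ → piece-< k′∈ v′<v c∈ e∈

  piece-interval : ∀ I₁ k v I₂ → let is = I₁ ++ (k , v) ∷ I₂ in (∀ {m} → m ∈ I₁ → v ≢ proj₂ m) → (∀ {m} → m ∈ I₂ → v ≢ proj₂ m) →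
                   Interval (block k) (concatMap (piece is) is)
  piece-interval I₁ k v I₂ ≢₁ ≢₂ = interval {before = concatMap P I₁} {after = concatMap P I₂}
    (concatMap-++ P I₁ ((k , v) ∷ I₂))
    (std-map (block k) (λ _ _ → ℕ.+-monoʳ-< (base is v)))
    ((λ c∈ → out ∈-++⁺ˡ ≢₁ c∈) , (λ c∈ → out (∈-++⁺ʳ I₁ ∘ there) ≢₂ c∈))
    where
    is = I₁ ++ (k , v) ∷ I₂
    P = piece is
    out : ∀ {I c} → (∀ {m} → m ∈ I → m ∈ is) → (∀ {m} → m ∈ I → v ≢ proj₂ m) → c ∈ concatMap P I → Outside (P (k , v)) c
    out {I} inc ≢s c∈ with find (∈-concatMap⁻ P {xs = I} c∈)
    ... | (k′ , v′) , m∈ , c∈P = piece-outside (∈-++⁺ʳ I₁ (here refl)) (inc m∈) (≢s m∈) c∈P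

∈-zip₂ : ∀ (xs ys : List ℕ) {m} → m ∈ zip xs ys → proj₂ m ∈ ys
∈-zip₂ (x ∷ xs) (y ∷ ys) (here refl) = here refl
∈-zip₂ (x ∷ xs) (y ∷ ys) (there m∈) = there (∈-zip₂ xs ys m∈)

-- Stated for `applyUpTo f`, because the tail of `upTo` is enumerated by a shifted function.
zip-split : ∀ (f : ℕ → ℕ) τ → Unique τ → (i : Fin (length τ)) →
            ∃₂ λ (I₁ : List (ℕ × ℕ)) (v : ℕ) → ∃ λ (I₂ : List (ℕ × ℕ)) → zip (applyUpTo f (length τ)) τ ≡ I₁ ++ (f (toℕ i) , v) ∷ I₂ ×
              (∀ {m} → m ∈ I₁ → v ≢ proj₂ m) × (∀ {m} → m ∈ I₂ → v ≢ proj₂ m)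
zip-split f (v ∷ τ) (v∉ ∷ _) zero = [] , v , zip (applyUpTo (f ∘ suc) (length τ)) τ , refl ,
  (λ ()) , λ m∈ → All.lookup v∉ (∈-zip₂ _ τ m∈)
zip-split f (w ∷ τ) (w∉ ∷ u) (suc i) with zip-split (f ∘ suc) τ u i
... | I₁ , v , I₂ , eq , ≢₁ , ≢₂ = (f 0 , w) ∷ I₁ , v , I₂ , cong ((f 0 , w) ∷_) eq ,
  (λ { (here refl) v≡w → All.lookup w∉ v∈ (sym v≡w) ; (there m∈) → ≢₁ m∈ }) , ≢₂
  where
  v∈ : v ∈ τ
  v∈ = ∈-zip₂ _ τ (subst ((f (suc (toℕ i)) , v) ∈_) (sym eq) (∈-++⁺ʳ I₁ (here refl)))

oneTo-unique : ∀ n → Unique (oneTo n)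
oneTo-unique n = Unique.map⁺ ℕ.suc-injective (Unique.upTo⁺ n)

permutation-unique : ∀ {τ} → τ ↭ oneTo (length τ) → Unique τ
permutation-unique τ↭ = Unique-resp-↭ (setoid ℕ) (↭⇒↭ₛ (↭-sym τ↭)) (oneTo-unique _)

module _ (τ : List ℕ) (unique : Unique τ) (i j : Fin (length τ)) (i≢j : i ≢ j) (φ ψ : List ℕ)
         (range-φ : All (λ e → 1 ≤ e × e ≤ length φ) φ) (range-ψ : All (λ e → 1 ≤ e × e ≤ length ψ) ψ) where

  block : ℕ → List ℕ
  block k = if k ≡ᵇ toℕ i then φ else (if k ≡ᵇ toℕ j then ψ else [ 1 ])

  range : ∀ k → All (λ e → 1 ≤ e × e ≤ length (block k)) (block k)
  range k with k ≡ᵇ toℕ i | k ≡ᵇ toℕ j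
  ... | true | _ = range-φ
  ... | false | true = range-ψ
  ... | false | false = (ℕ.≤-refl , ℕ.≤-refl) ∷ []

  open Inflation block range

  block-i : block (toℕ i) ≡ φ
  block-i with toℕ i ≡ᵇ toℕ i | ℕ.≡⇒≡ᵇ (toℕ i) (toℕ i) refl
  ... | true | _ = refl

  block-j : block (toℕ j) ≡ ψ
  block-j with toℕ j ≡ᵇ toℕ i in eq | toℕ j ≡ᵇ toℕ j | ℕ.≡⇒≡ᵇ (toℕ j) (toℕ j) refl
  ... | true | _ | _ = contradiction (sym (Fin.toℕ-injective (ℕ.≡ᵇ⇒≡ (toℕ j) (toℕ i) (subst T (sym eq) _)))) i≢j
  ... | false | true | _ = refl

  inflate-interval : ∀ k → Interval (block (toℕ k)) (inflate τ (toℕ i) (toℕ j) φ ψ)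
  inflate-interval k with zip-split id τ unique k
  ... | I₁ , v , I₂ , eq , ≢₁ , ≢₂ =
    subst (λ is → Interval (block (toℕ k)) (concatMap (piece is) is)) (sym eq) (piece-interval I₁ (toℕ k) v I₂ ≢₁ ≢₂)

  inflate-interval-φ : Interval φ (inflate τ (toℕ i) (toℕ j) φ ψ)
  inflate-interval-φ = subst (λ p → Interval p (inflate τ (toℕ i) (toℕ j) φ ψ)) block-i (inflate-interval i)

  inflate-interval-ψ : Interval ψ (inflate τ (toℕ i) (toℕ j) φ ψ)
  inflate-interval-ψ = subst (λ p → Interval p (inflate τ (toℕ i) (toℕ j) φ ψ)) block-j (inflate-interval j)

-- The annihilator pair

Interval⇒≼ : ∀ {p L} → Interval p L → p ≼ L
Interval⇒≼ (interval {X} {w} {Z} refl eq _) = w , Sub.++⁺ˡ X (Sub.++⁺ʳ Z ⊆-refl) , eq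

theorem6p1 : (τ : List ℕ) → τ ↭ oneTo (length τ) → (i j : Fin (length τ)) → i ≢ j →
    μ (1 ∷ []) (inflate τ (toℕ i) (toℕ j) (2 ∷ 1 ∷ 3 ∷ []) (2 ∷ 4 ∷ 3 ∷ 1 ∷ [])) ≡ 0ℤ
-- The inflation contains `213`, so its length is at least 3 and not 1.
theorem6p1 τ τ↭ i j i≢j = μ-one≡0 π (λ len → contradiction (subst (3 ≤_) len (≼-length {p213} (Interval⇒≼ {p213} i213))) λ { (s≤s ()) })
  (interval-213-2431-vanishes i213 i2431)
  where
  π : List ℕ
  π = inflate τ (toℕ i) (toℕ j) p213 p2431

  range? : ∀ p → Dec (All (λ e → 1 ≤ e × e ≤ length p) p)
  range? p = all? (λ e → 1 ≤? e ×-dec e ≤? length p) p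

  i213 : Interval p213 π
  i213 = inflate-interval-φ τ (permutation-unique τ↭) i j i≢j p213 p2431 (toWitness {a? = range? p213} _) (toWitness {a? = range? p2431} _)

  i2431 : Interval p2431 π
  i2431 = inflate-interval-ψ τ (permutation-unique τ↭) i j i≢j p213 p2431 (toWitness {a? = range? p213} _) (toWitness {a? = range? p2431} _)
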